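{- If $L$ is a non-scattered nonempty linear order, then $\mathrm{Val}_{\mathrm{LO}^{\mathrm{cond}}}(L,\mathcal L^{\Diamond}_{\le}(L))=\mathsf{S4.2.1}$. Consequently, the set of propositional modal formulas valid at every world $W$ of $\mathrm{LO}^{\mathrm{cond}}$ with respect to $\mathcal L^{\Diamond}_{\le}(W)$ is exactly $\mathsf{S4.2.1}$.
   Context: A linear order is scattered if it contains no copy of $(\mathbb Q,\le)$. A condensation is a surjective monotone map between nonempty linear orders; $\mathrm{LO}^{\mathrm{cond}}$ is the category of nonempty linear orders and condensations. $\mathcal L^{\Diamond}_{\le}(W)$ is the modal extension (operators $\Diamond,\Box$) of $\{\le\}$ with constants naming elements of $W$ (transported along morphisms). Modal satisfaction: $U\models\Diamond\varphi[\nu]$ iff there is a morphism $f:U\to V$ with $V\models\varphi[f\circ\nu]$; $\Box$ dually. $\mathrm{Val}(W,\Gamma)$ is the set of propositional modal formulas $\psi(p_0,\dots,p_n)$ all of whose substitution instances $\psi(\varphi_0,\dots,\varphi_n)$ with $\varphi_i\in\Gamma$ hold at $W$. $\mathsf{S4.2.1}$ is the normal modal logic axiomatized by $\Box p\to p$, $\Box p\to\Box\Box p$, $\Diamond\Box p\to\Box\Diamond p$, and $\Box\Diamond p\to\Diamond\Box p$. -}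

module Defs where

open import Level using (Level; 0ℓ; Lift) renaming (suc to lsuc)
open import Data.Nat using (ℕ; zero; suc)
open import Data.Fin using (Fin)
open import Data.Bool using (Bool; true; false; _∧_; _∨_; not)
open import Data.Product using (Σ; Σ-syntax; ∃; _×_; _,_; proj₁; proj₂)
open import Data.Sum using (_⊎_)
open import Data.Empty using (⊥)
open import Data.Rational as ℚ using (ℚ)
open import Relation.Nullary using (¬_)
open import Relation.Binary.PropositionalEquality using (_≡_; _≢_; refl; cong)
open import Relation.Binary.Structures using (IsTotalOrder)

record LO : Set₁ where
  field
    Carrier      : Set
    _≤_          : Carrier → Carrier → Set
    isTotalOrder : IsTotalOrder _≡_ _≤_
    inhabitant   : Carrier

open LO public using (Carrier)

_⊢_≤_ : (U : LO) → Carrier U → Carrier U → Set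
U ⊢ x ≤ y = LO._≤_ U x y

_⊢_<_ : (U : LO) → Carrier U → Carrier U → Set
U ⊢ x < y = (U ⊢ x ≤ y) × (x ≢ y)

Scattered : LO → Set
Scattered L = ¬ (Σ (ℚ → Carrier L) λ e →
                   ∀ p q → p ℚ.< q → L ⊢ e p < e q)

record Cond (U V : LO) : Set where
  field
    fun        : Carrier U → Carrier V
    monotone   : ∀ {x y} → U ⊢ x ≤ y → V ⊢ fun x ≤ fun y
    surjective : ∀ v → Σ (Carrier U) λ u → fun u ≡ v

open Cond public using (fun)

idC : (U : LO) → Cond U U
idC U = record { fun = λ x → x ; monotone = λ p → p ; surjective = λ v → v , refl }

_∘C_ : {U V X : LO} → Cond V X → Cond U V → Cond U X
_∘C_ {U} {V} {X} g f = record
  { fun = λ x → fun g (fun f x)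
  ; monotone = λ p → Cond.monotone g (Cond.monotone f p)
  ; surjective = λ z → let (v , gv) = Cond.surjective g z
                           (u , fu) = Cond.surjective f v
                       in u , Relation.Binary.PropositionalEquality.trans (cong (fun g) fu) gv
  }
  where import Relation.Binary.PropositionalEquality

data Tm (W : LO) (n : ℕ) : Set where
  var   : Fin n → Tm W n
  const : Carrier W → Tm W n

data Fm (W : LO) : ℕ → Set where
  _≤'_ _≐_      : ∀ {n} → Tm W n → Tm W n → Fm W n
  ⊥'            : ∀ {n} → Fm W n
  _⇒_ _∧'_ _∨'_ : ∀ {n} → Fm W n → Fm W n → Fm W n
  ∀' ∃'         : ∀ {n} → Fm W (suc n) → Fm W n
  □' ◇'         : ∀ {n} → Fm W n → Fm W n

Sentence : LO → Set
Sentence W = Fm W 0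

extend : ∀ {A : Set} {n} → A → (Fin n → A) → Fin (suc n) → A
extend a ν Fin.zero    = a
extend a ν (Fin.suc i) = ν i

⟦_⟧ : ∀ {W U n} → Tm W n → Cond W U → (Fin n → Carrier U) → Carrier U
⟦ var i   ⟧ g ν = ν i
⟦ const w ⟧ g ν = fun g w

Sat : ∀ {W n} (U : LO) → Cond W U → (Fin n → Carrier U) → Fm W n → Set₁
Sat U g ν (s ≤' t) = Lift (lsuc 0ℓ) (U ⊢ ⟦ s ⟧ g ν ≤ ⟦ t ⟧ g ν)
Sat U g ν (s ≐ t)  = Lift (lsuc 0ℓ) (⟦ s ⟧ g ν ≡ ⟦ t ⟧ g ν)
Sat U g ν ⊥'       = Lift (lsuc 0ℓ) ⊥
Sat U g ν (φ ⇒ ψ)  = Sat U g ν φ → Sat U g ν ψ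
Sat U g ν (φ ∧' ψ) = Sat U g ν φ × Sat U g ν ψ
Sat U g ν (φ ∨' ψ) = Sat U g ν φ ⊎ Sat U g ν ψ
Sat U g ν (∀' φ)   = (a : Carrier U) → Sat U g (extend a ν) φ
Sat U g ν (∃' φ)   = Σ (Lift (lsuc 0ℓ) (Carrier U)) λ a → Sat U g (extend (Level.lower a) ν) φ
Sat U g ν (□' φ)   = (V : LO) (f : Cond U V) → Sat V (f ∘C g) (λ i → fun f (ν i)) φ
Sat U g ν (◇' φ)   = Σ LO λ V → Σ (Cond U V) λ f → Sat V (f ∘C g) (λ i → fun f (ν i)) φ

HoldsAt : (W : LO) → Sentence W → Set₁
HoldsAt W φ = Sat W (idC W) (λ ()) φ

data PF : Set where
  p           : ℕ → PF
  ⊥ₚ          : PF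
  _⇒ₚ_ _∧ₚ_ _∨ₚ_ : PF → PF → PF
  □ₚ ◇ₚ       : PF → PF

¬ₚ : PF → PF
¬ₚ a = a ⇒ₚ ⊥ₚ

inst : ∀ {W} → (ℕ → Sentence W) → PF → Sentence W
inst σ (p i)    = σ i
inst σ ⊥ₚ       = ⊥'
inst σ (a ⇒ₚ b) = inst σ a ⇒ inst σ b
inst σ (a ∧ₚ b) = inst σ a ∧' inst σ b
inst σ (a ∨ₚ b) = inst σ a ∨' inst σ b
inst σ (□ₚ a)   = □' (inst σ a)
inst σ (◇ₚ a)   = ◇' (inst σ a)

Val : (W : LO) → PF → Set₁
Val W ψ = (σ : ℕ → Sentence W) → HoldsAt W (inst σ ψ)

-- Boolean evaluation treating p i, □a, ◇a as atoms
evalB : (PF → Bool) → PF → Bool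
evalB v (p i)    = v (p i)
evalB v ⊥ₚ       = false
evalB v (a ⇒ₚ b) = not (evalB v a) ∨ evalB v b
evalB v (a ∧ₚ b) = evalB v a ∧ evalB v b
evalB v (a ∨ₚ b) = evalB v a ∨ evalB v b
evalB v (□ₚ a)   = v (□ₚ a)
evalB v (◇ₚ a)   = v (◇ₚ a)

-- instances of classical propositional tautologies
Taut : PF → Set
Taut a = ∀ v → evalB v a ≡ true

data S4∙2∙1 : PF → Set where
  taut  : ∀ {a} → Taut a → S4∙2∙1 a
  K     : ∀ a b → S4∙2∙1 (□ₚ (a ⇒ₚ b) ⇒ₚ (□ₚ a ⇒ₚ □ₚ b))
  dual₁ : ∀ a → S4∙2∙1 (◇ₚ a ⇒ₚ ¬ₚ (□ₚ (¬ₚ a)))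
  dual₂ : ∀ a → S4∙2∙1 (¬ₚ (□ₚ (¬ₚ a)) ⇒ₚ ◇ₚ a)
  T     : ∀ a → S4∙2∙1 (□ₚ a ⇒ₚ a)
  four  : ∀ a → S4∙2∙1 (□ₚ a ⇒ₚ □ₚ (□ₚ a))
  dot2  : ∀ a → S4∙2∙1 (◇ₚ (□ₚ a) ⇒ₚ □ₚ (◇ₚ a))
  dot1  : ∀ a → S4∙2∙1 (□ₚ (◇ₚ a) ⇒ₚ ◇ₚ (□ₚ a))
  mp    : ∀ {a b} → S4∙2∙1 (a ⇒ₚ b) → S4∙2∙1 a → S4∙2∙1 b
  nec   : ∀ {a} → S4∙2∙1 a → S4∙2∙1 (□ₚ a)

{-# OPTIONS --safe #-}
module Submission where

-- Soundness: every linear order condenses onto the one-point order, which is final.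
--
-- Completeness: an unprovable ψ fails in a finite preorder with a greatest world τ that
-- sees only itself.  Such a frame is simulated by the condensations of L.  Copy ℚ into L and
-- name points c₀ < … < c_N < d of the copy, N being the number of worlds.  "cᵢ = cᵢ₊₁" is a
-- button for the i-th world: once pressed it stays pressed, and the buttons are independent.
-- If some point of every final segment below d has no immediate successor, then collapsing
-- intervals (c_N , b] and [c_N , b] with such b makes the length of the chain of immediate
-- successors starting at c_N take any value, again and again; this is a dial.  A world V gets
-- the label τ if no condensation of V has such points below d, or if the worlds of the pressed
-- buttons do not form a chain; otherwise its label lies in the cluster of the greatest pressed
-- world, and the dial selects it inside this cluster.
open import Defs
open import Level using (0ℓ; Lift; lift; lower) renaming (suc to lsuc)
open import Axiom.ExcludedMiddle using (ExcludedMiddle)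
open import Axiom.UniquenessOfIdentityProofs.WithK using (uip)
open import Data.Bool using (Bool; true; false; _∧_; _∨_; not; if_then_else_)
open import Data.Empty using (⊥; ⊥-elim)
open import Data.Fin using (Fin; zero; suc; toℕ; fromℕ<)
open import Data.Fin.Properties using (toℕ<n; fromℕ<-toℕ; toℕ-injective)
open import Data.List as List using (List; []; _∷_; _++_; length; map)
open import Data.List.Membership.Propositional using (_∈_)
open import Data.List.Membership.Propositional.Properties using (∈-++⁺ˡ; ∈-++⁺ʳ; ∈-map⁺)
open import Data.List.Relation.Unary.Any using (here; there; index)
open import Data.List.Relation.Unary.Any.Properties using (lookup-index)
open import Data.Nat as ℕ using (ℕ; zero; suc)
import Data.Nat.Properties as ℕ
open import Data.Product using (Σ; _×_; _,_; proj₁; proj₂)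
open import Data.Rational as ℚ using (ℚ)
import Data.Rational.Properties as ℚ
open import Data.Sum using (_⊎_; inj₁; inj₂; [_,_]′)
open import Data.Unit using (⊤; tt)
open import Data.Vec using (Vec; []; _∷_; lookup)
open import Function.Bundles using (_⇔_; mk⇔; Equivalence)
open import Relation.Binary.Definitions using (tri<; tri≈; tri>)
open import Relation.Binary.PropositionalEquality using (_≡_; _≢_; refl; sym; trans; cong; subst; subst₂; isEquivalence)
open import Relation.Binary.Structures using (IsTotalOrder)
open import Relation.Nullary using (¬_; Dec; yes; no; does)
open import Relation.Nullary.Decidable using (map′; dec-true)

-- Derivations in S4.2.1

infix 4 ⊢_ _⊢ₚ_
⊢_ : PF → Set
⊢ a = S4∙2∙1 a

-- Hypotheses are gathered in one formula and discharged as an implication, so that `nec` is applied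
-- to theorems only.
_⊢ₚ_ : PF → PF → Set
χ ⊢ₚ a = ⊢ (χ ⇒ₚ a)

abstract
  ⊢-K : ∀ a b → ⊢ (a ⇒ₚ (b ⇒ₚ a))
  ⊢-K a b = taut λ v → lem (evalB v a) (evalB v b)
    where
    lem : ∀ x y → (not x ∨ (not y ∨ x)) ≡ true
    lem false _ = refl
    lem true false = refl
    lem true true = refl

  ⊢-S : ∀ a b c → ⊢ ((a ⇒ₚ (b ⇒ₚ c)) ⇒ₚ ((a ⇒ₚ b) ⇒ₚ (a ⇒ₚ c)))
  ⊢-S a b c = taut λ v → lem (evalB v a) (evalB v b) (evalB v c)
    where
    lem : ∀ x y z → (not (not x ∨ (not y ∨ z)) ∨ (not (not x ∨ y) ∨ (not x ∨ z))) ≡ true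
    lem false _ _ = refl
    lem true false _ = refl
    lem true true false = refl
    lem true true true = refl

  ⊢-pair : ∀ a b → ⊢ (a ⇒ₚ (b ⇒ₚ (a ∧ₚ b)))
  ⊢-pair a b = taut λ v → lem (evalB v a) (evalB v b)
    where
    lem : ∀ x y → (not x ∨ (not y ∨ (x ∧ y))) ≡ true
    lem false _ = refl
    lem true false = refl
    lem true true = refl

  ⊢-fst : ∀ a b → ⊢ ((a ∧ₚ b) ⇒ₚ a)
  ⊢-fst a b = taut λ v → lem (evalB v a) (evalB v b)
    where
    lem : ∀ x y → (not (x ∧ y) ∨ x) ≡ true
    lem false _ = refl
    lem true false = refl
    lem true true = refl

  ⊢-snd : ∀ a b → ⊢ ((a ∧ₚ b) ⇒ₚ b)
  ⊢-snd a b = taut λ v → lem (evalB v a) (evalB v b)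
    where
    lem : ∀ x y → (not (x ∧ y) ∨ y) ≡ true
    lem false _ = refl
    lem true false = refl
    lem true true = refl

  ⊢-inl : ∀ a b → ⊢ (a ⇒ₚ (a ∨ₚ b))
  ⊢-inl a b = taut λ v → lem (evalB v a) (evalB v b)
    where
    lem : ∀ x y → (not x ∨ (x ∨ y)) ≡ true
    lem false _ = refl
    lem true _ = refl

  ⊢-inr : ∀ a b → ⊢ (b ⇒ₚ (a ∨ₚ b))
  ⊢-inr a b = taut λ v → lem (evalB v a) (evalB v b)
    where
    lem : ∀ x y → (not y ∨ (x ∨ y)) ≡ true
    lem false false = refl
    lem false true = refl
    lem true false = refl
    lem true true = refl

  ⊢-case : ∀ a b → ⊢ (¬ₚ a ⇒ₚ (¬ₚ b ⇒ₚ ¬ₚ (a ∨ₚ b)))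
  ⊢-case a b = taut λ v → lem (evalB v a) (evalB v b)
    where
    lem : ∀ x y → (not (not x ∨ false) ∨ (not (not y ∨ false) ∨ (not (x ∨ y) ∨ false))) ≡ true
    lem false false = refl
    lem false true = refl
    lem true _ = refl

  ⊢-efq : ∀ a → ⊢ (⊥ₚ ⇒ₚ a)
  ⊢-efq a = taut λ v → refl

  ⊢-dne : ∀ a → ⊢ (¬ₚ (¬ₚ a) ⇒ₚ a)
  ⊢-dne a = taut λ v → lem (evalB v a)
    where
    lem : ∀ x → (not (not (not x ∨ false) ∨ false) ∨ x) ≡ true
    lem false = refl
    lem true = refl

  module _ {χ : PF} where
    const-⊢ : ∀ {a} → ⊢ a → χ ⊢ₚ a
    const-⊢ h = mp (⊢-K _ _) h

    app : ∀ {a b} → χ ⊢ₚ (a ⇒ₚ b) → χ ⊢ₚ a → χ ⊢ₚ b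
    app f x = mp (mp (⊢-S _ _ _) f) x

    infixr 5 _·_
    _·_ : ∀ {a b} → ⊢ (a ⇒ₚ b) → χ ⊢ₚ a → χ ⊢ₚ b
    f · x = app (const-⊢ f) x

    pair : ∀ {a b} → χ ⊢ₚ a → χ ⊢ₚ b → χ ⊢ₚ (a ∧ₚ b)
    pair x y = app (⊢-pair _ _ · x) y

  hyp : ∀ {χ} → χ ⊢ₚ χ
  hyp {χ} = mp (mp (⊢-S χ (χ ⇒ₚ χ) χ) (⊢-K χ (χ ⇒ₚ χ))) (⊢-K χ χ)

  fst : ∀ {χ a b} → χ ⊢ₚ (a ∧ₚ b) → χ ⊢ₚ a
  fst x = ⊢-fst _ _ · x

  snd : ∀ {χ a b} → χ ⊢ₚ (a ∧ₚ b) → χ ⊢ₚ b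
  snd x = ⊢-snd _ _ · x

  deduce : ∀ {χ a b} → (χ ∧ₚ a) ⊢ₚ b → χ ⊢ₚ (a ⇒ₚ b)
  deduce {χ} {a} h = app (⊢-S _ _ _ · const-⊢ (const-⊢ h)) (⊢-pair χ a)

  by-contradiction : ∀ {χ a} → (χ ∧ₚ ¬ₚ a) ⊢ₚ ⊥ₚ → χ ⊢ₚ a
  by-contradiction h = ⊢-dne _ · deduce h

  □-mono : ∀ {a b} → ⊢ (a ⇒ₚ b) → ⊢ (□ₚ a ⇒ₚ □ₚ b)
  □-mono h = mp (K _ _) (nec h)

  □-pair : ∀ {χ a b} → χ ⊢ₚ □ₚ a → χ ⊢ₚ □ₚ b → χ ⊢ₚ □ₚ (a ∧ₚ b)
  □-pair x y = app (K _ _ · □-mono (⊢-pair _ _) · x) y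

  -- Serves as elimination rule for `◇ₚ`: pass to a world satisfying `b` and use there what was
  -- boxed. Formally, `□ₚ a` yields `□ₚ (¬ₚ b)`.
  □-◇-contradiction : ∀ {χ a b} → (a ∧ₚ b) ⊢ₚ ⊥ₚ → χ ⊢ₚ □ₚ a → χ ⊢ₚ ◇ₚ b → χ ⊢ₚ ⊥ₚ
  □-◇-contradiction h x y = app (dual₁ _ · y) (□-mono (deduce h) · x)

  ¬◇⇒□¬ : ∀ {χ a} → χ ⊢ₚ ¬ₚ (◇ₚ a) → χ ⊢ₚ □ₚ (¬ₚ a)
  ¬◇⇒□¬ h = by-contradiction (app (h · fst hyp) (dual₂ _ · snd hyp))

  ¬□⇒◇¬ : ∀ {a} → ⊢ (¬ₚ (□ₚ a) ⇒ₚ ◇ₚ (¬ₚ a))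
  ¬□⇒◇¬ = dual₂ _ · deduce (app (fst hyp) (□-mono (⊢-dne _) · snd hyp))

  ◇-mono : ∀ {a b} → ⊢ (a ⇒ₚ b) → ⊢ (◇ₚ a ⇒ₚ ◇ₚ b)
  ◇-mono h = dual₂ _ · deduce (□-◇-contradiction (app (fst hyp) (h · snd hyp)) (snd hyp) (fst hyp))

  ◇□⇒□◇□ : ∀ {a} → ⊢ (◇ₚ (□ₚ a) ⇒ₚ □ₚ (◇ₚ (□ₚ a)))
  ◇□⇒□◇□ = dot2 _ · ◇-mono (four _)

  -- The hypothesis makes `◇ₚ (¬ₚ a)` necessary, and the McKinsey axiom `dot1` swaps the modalities.
  ◇□-decides : ∀ {χ a} → χ ⊢ₚ ¬ₚ (◇ₚ (□ₚ a)) → χ ⊢ₚ ◇ₚ (□ₚ (¬ₚ a))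
  ◇□-decides h = dot1 _ · □-mono ¬□⇒◇¬ · ¬◇⇒□¬ h

  -- By directedness `◇ₚ (□ₚ b)` persists in all accessible worlds. Move to a world with `□ₚ a` and
  -- from there to one with `□ₚ b`; the former box persists by `four`.
  ◇□-pair : ∀ {χ a b} → χ ⊢ₚ ◇ₚ (□ₚ a) → χ ⊢ₚ ◇ₚ (□ₚ b) → χ ⊢ₚ ◇ₚ (□ₚ (a ∧ₚ b))
  ◇□-pair {a = a} {b} x y = by-contradiction
    (□-◇-contradiction inner
      (□-pair (◇□⇒□◇□ · y · fst hyp) (four _ · ¬◇⇒□¬ (snd hyp)))
      (x · fst hyp))
    where
    innermost : ((□ₚ a ∧ₚ ¬ₚ (□ₚ (a ∧ₚ b))) ∧ₚ □ₚ b) ⊢ₚ ⊥ₚ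
    innermost = app (snd (fst hyp)) (□-pair (fst (fst hyp)) (snd hyp))
    inner : ((◇ₚ (□ₚ b) ∧ₚ □ₚ (¬ₚ (□ₚ (a ∧ₚ b)))) ∧ₚ □ₚ a) ⊢ₚ ⊥ₚ
    inner = □-◇-contradiction innermost (□-pair (four _ · snd hyp) (snd (fst hyp))) (fst (fst hyp))

-- Finite models of S4.2.1

-- Repetitions in `enum` are allowed; each index gets a button of its own.
record Frame : Set₁ where
  field
    X          : Set
    R          : X → X → Set
    R-refl     : ∀ {x} → R x x
    R-trans    : ∀ {x y z} → R x y → R y z → R x z
    τ          : X
    top        : ∀ x → R x τ
    final      : ∀ {x} → R τ x → x ≡ τ
    size       : ℕ
    enum       : Fin size → X
    enum-index : ∀ x → Σ (Fin size) λ i → enum i ≡ x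

module Forcing (F : Frame) (val : Frame.X F → ℕ → Bool) where
  open Frame F

  Forces : X → PF → Set
  Forces x (p i)    = val x i ≡ true
  Forces x ⊥ₚ       = ⊥
  Forces x (a ⇒ₚ b) = Forces x a → Forces x b
  Forces x (a ∧ₚ b) = Forces x a × Forces x b
  Forces x (a ∨ₚ b) = Forces x a ⊎ Forces x b
  Forces x (□ₚ a)   = ∀ y → R x y → Forces y a
  Forces x (◇ₚ a)   = Σ X λ y → R x y × Forces y a

-- Sign vectors and Lindenbaum extensions

allVecs : ∀ n → List (Vec Bool n)
allVecs zero    = [] ∷ []
allVecs (suc n) = map (true ∷_) (allVecs n) ++ map (false ∷_) (allVecs n)

∈-allVecs : ∀ {n} (v : Vec Bool n) → v ∈ allVecs n
∈-allVecs []          = here refl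
∈-allVecs (true ∷ v)  = ∈-++⁺ˡ (∈-map⁺ (true ∷_) (∈-allVecs v))
∈-allVecs (false ∷ v) = ∈-++⁺ʳ _ (∈-map⁺ (false ∷_) (∈-allVecs v))

Consistent : PF → Set
Consistent χ = ¬ (χ ⊢ₚ ⊥ₚ)

consistent-mono : ∀ {χ χ′} → χ ⊢ₚ χ′ → Consistent χ → Consistent χ′
consistent-mono h c k = c (k · h)

⊤ₚ : PF
⊤ₚ = ⊥ₚ ⇒ₚ ⊥ₚ

lit : PF → Bool → PF
lit a true  = a
lit a false = ¬ₚ a

lits : (as : List PF) → Vec Bool (length as) → PF
lits []       []       = ⊤ₚ
lits (a ∷ as) (b ∷ bs) = lit a b ∧ₚ lits as bs

lits-decide : ∀ as v {a} → a ∈ as → (lits as v ⊢ₚ a) ⊎ (lits as v ⊢ₚ ¬ₚ a)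
lits-decide (a ∷ as) (true ∷ bs)  (here refl) = inj₁ (fst hyp)
lits-decide (a ∷ as) (false ∷ bs) (here refl) = inj₂ (fst hyp)
lits-decide (a ∷ as) (b ∷ bs)     (there i) with lits-decide as bs i
... | inj₁ h = inj₁ (h · snd hyp)
... | inj₂ h = inj₂ (h · snd hyp)

-- The atoms and boxed formulas whose signs determine the truth value of a.
base : PF → List PF
base (p i)    = p i ∷ []
base ⊥ₚ       = []
base (a ⇒ₚ b) = base a ++ base b
base (a ∧ₚ b) = base a ++ base b
base (a ∨ₚ b) = base a ++ base b
base (□ₚ a)   = □ₚ a ∷ base a
base (◇ₚ a)   = □ₚ (¬ₚ a) ∷ base a

module Classical (em : ExcludedMiddle (lsuc 0ℓ)) where

  em₀ : {P : Set} → Dec P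
  em₀ {P} = map′ lower lift (em {Lift (lsuc 0ℓ) P})

  decided-true : {P : Set} → P → does (em₀ {P}) ≡ true
  decided-true {P} = dec-true (em₀ {P})

  true-decided : {P : Set} → does (em₀ {P}) ≡ true → P
  true-decided {P} = witness (em₀ {P})
    where
    witness : (d : Dec P) → does d ≡ true → P
    witness (yes h) _ = h

  abstract
    split-consistent : ∀ χ a → Consistent χ → Σ Bool λ b → Consistent (χ ∧ₚ lit a b)
    split-consistent χ a c with em₀ {Consistent (χ ∧ₚ a)}
    ... | yes h = true , h
    ... | no k  = false , λ h → k λ h′ → c (app (deduce h) (deduce h′))

    lindenbaum : ∀ as {χ} → Consistent χ →
      Σ (Vec Bool (length as)) λ v → Consistent (χ ∧ₚ lits as v)
    lindenbaum [] c = [] , consistent-mono (pair hyp (const-⊢ hyp)) c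
    lindenbaum (a ∷ as) {χ} c with split-consistent χ a c
    ... | b , c₁ with lindenbaum as c₁
    ... | v , c₂ = b ∷ v , consistent-mono (pair (fst (fst hyp)) (pair (snd (fst hyp)) (snd hyp))) c₂

    -- The McKinsey axiom makes every formula or its negation eventually true forever; directedness
    -- does this for finitely many formulas at once.
    eventual-lits : ∀ as {χ} → Consistent χ →
      Σ (Vec Bool (length as)) λ v → Consistent (χ ∧ₚ ◇ₚ (□ₚ (lits as v)))
    eventual-lits [] c = [] ,
      consistent-mono (pair hyp (const-⊢ (mp (dual₂ _) (app (T _ · hyp) (const-⊢ (nec hyp)))))) c
    eventual-lits (a ∷ as) {χ} c with eventual-lits as c
    ... | v , c₁ with split-consistent _ (◇ₚ (□ₚ a)) c₁
    ... | true , c₂ = true ∷ v ,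
          consistent-mono (pair (fst (fst hyp)) (◇□-pair (snd hyp) (snd (fst hyp)))) c₂
    ... | false , c₂ = false ∷ v ,
          consistent-mono (pair (fst (fst hyp)) (◇□-pair (◇□-decides (snd hyp)) (snd (fst hyp)))) c₂

  -- The finite canonical model

  module FiniteModel (ψ : PF) (t : Vec Bool (length (base ψ)))
    (γ-consistent : Consistent (¬ₚ ψ ∧ₚ □ₚ (◇ₚ (□ₚ (lits (base ψ) t))))) where

    as : List PF
    as = base ψ

    n : ℕ
    n = length as

    -- γ says that the signs t hold eventually.  Since γ implies □ γ, it may be imposed on all worlds.
    γ : PF
    γ = □ₚ (◇ₚ (□ₚ (lits as t)))

    thy : Vec Bool n → PF
    thy v = γ ∧ₚ lits as v

    -- Consistency is stored as a Boolean equation, whose proofs are unique, so a world is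
    -- determined by its signs.
    World : Set
    World = Σ (Vec Bool n) λ v → does (em₀ {Consistent (thy v)}) ≡ true

    world : ∀ v → Consistent (thy v) → World
    world v c = v , decided-true c

    World-≡ : {u v : World} → proj₁ u ≡ proj₁ v → u ≡ v
    World-≡ {u , e} {.u , e′} refl = cong (u ,_) (uip e e′)

    infix 4 _⊩_
    _⊩_ : World → PF → Set
    w ⊩ a = thy (proj₁ w) ⊢ₚ a

    consistent : ∀ w {a} → w ⊩ a → w ⊩ ¬ₚ a → ⊥
    consistent w h k = true-decided (proj₂ w) (app k h)

    decide : ∀ w {a} → a ∈ as → (w ⊩ a) ⊎ (w ⊩ ¬ₚ a)
    decide w i with lits-decide as (proj₁ w) i
    ... | inj₁ h = inj₁ (h · snd hyp)
    ... | inj₂ h = inj₂ (h · snd hyp)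

    -- Under `γ` a world where the signs `t` hold is always accessible. Both `γ` and the boxed `a`
    -- survive the passage to it.
    ◇-top : ∀ {χ a} → χ ⊢ₚ γ → (thy t ⊢ₚ ¬ₚ a) → χ ⊢ₚ □ₚ a → χ ⊢ₚ ⊥ₚ
    ◇-top g h k = □-◇-contradiction
      (app (h · pair (fst (fst hyp)) (T _ · snd hyp)) (snd (fst hyp)))
      (□-pair (four _ · g) k) (T _ · g)

    τ : World
    -- If `thy t` were inconsistent, it would refute a boxed theorem, which `◇-top` forbids.
    τ = world t λ h → γ-consistent
      (◇-top (snd hyp) (⊢-efq _ · h) (const-⊢ (nec (hyp {⊥ₚ}))))

    -- The second component makes τ final; by τ-box it removes no witness that τ needs.
    R : World → World → Set
    R u v = (∀ {b} → □ₚ b ∈ as → u ⊩ □ₚ b → v ⊩ □ₚ b) × (u ≡ τ → v ≡ τ)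

    -- The boxed formulas of `w` as a single hypothesis. By `four` it implies its own box, so it can
    -- be carried into a successor.
    boxes : World → List PF → PF
    boxes w [] = ⊤ₚ
    boxes w (a ∷ bs) with em₀ {(Σ PF λ b → a ≡ □ₚ b) × w ⊩ a}
    ... | yes _ = a ∧ₚ boxes w bs
    ... | no _  = boxes w bs

    ⊩-boxes : ∀ w bs → w ⊩ boxes w bs
    ⊩-boxes w [] = const-⊢ hyp
    ⊩-boxes w (a ∷ bs) with em₀ {(Σ PF λ b → a ≡ □ₚ b) × w ⊩ a}
    ... | yes (_ , h) = pair h (⊩-boxes w bs)
    ... | no _        = ⊩-boxes w bs

    boxes-□ : ∀ w bs → boxes w bs ⊢ₚ □ₚ (boxes w bs)
    boxes-□ w [] = const-⊢ (nec hyp)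
    boxes-□ w (a ∷ bs) with em₀ {(Σ PF λ b → a ≡ □ₚ b) × w ⊩ a}
    ... | yes ((b , refl) , _) = □-pair (four _ · fst hyp) (boxes-□ w bs · snd hyp)
    ... | no _                 = boxes-□ w bs

    boxes-∈ : ∀ w bs {b} → □ₚ b ∈ bs → w ⊩ □ₚ b → boxes w bs ⊢ₚ □ₚ b
    boxes-∈ w (a ∷ bs) {b} i h with em₀ {(Σ PF λ b → a ≡ □ₚ b) × w ⊩ a} | i
    ... | yes _ | here refl = fst hyp
    ... | yes _ | there j   = boxes-∈ w bs j h · snd hyp
    ... | no k  | here refl = ⊥-elim (k ((b , refl) , h))
    ... | no _  | there j   = boxes-∈ w bs j h

    -- Where the signs `t` hold permanently, so does every consequence of `thy t`; hence `□ₚ a` is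
    -- reachable. From there `◇-top` reaches signs `t` again, where `□ₚ a` would be both preserved
    -- and refuted.
    τ-box : ∀ {a} → τ ⊩ a → τ ⊩ ¬ₚ (□ₚ a) → ⊥
    τ-box {a} k h = γ-consistent contradictory
      where
      ◇□a : γ ⊢ₚ ◇ₚ (□ₚ a)
      ◇□a = by-contradiction (□-◇-contradiction
              (app (snd (fst hyp)) (□-mono k · □-pair (fst (fst hyp)) (snd hyp)))
              (□-pair (four _ · four _ · fst hyp) (¬◇⇒□¬ (snd hyp)))
              (T _ · fst hyp))
      contradictory : (¬ₚ ψ ∧ₚ γ) ⊢ₚ ⊥ₚ
      contradictory = □-◇-contradiction {a = γ} {b = □ₚ a}
        (◇-top (fst hyp) h (four _ · snd hyp)) (four _ · snd hyp) (◇□a · snd hyp)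

    -- If `χ` were inconsistent, `γ` and the boxes of `w` would prove `a`; as both imply their own
    -- boxes, `w` would prove `□ₚ a`. A Lindenbaum extension of `χ` is the required world.
    successor : ∀ w {a} → (∀ u → (u ⊩ a) ⊎ (u ⊩ ¬ₚ a)) → w ≢ τ → w ⊩ ¬ₚ (□ₚ a) →
      Σ World λ u → R w u × u ⊩ ¬ₚ a
    successor w {a} dec w≢τ h = u , (sub , λ e → ⊥-elim (w≢τ e)) , u⊩¬a (dec u)
      where
      χ : PF
      χ = (γ ∧ₚ boxes w as) ∧ₚ ¬ₚ a
      χ-consistent : Consistent χ
      χ-consistent k = consistent w
        (□-mono (by-contradiction k) ·
          □-pair (four _ · fst hyp) (boxes-□ w as · ⊩-boxes w as)) h
      v : Vec Bool n
      v = proj₁ (lindenbaum as χ-consistent)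
      v-consistent : Consistent (χ ∧ₚ lits as v)
      v-consistent = proj₂ (lindenbaum as χ-consistent)
      χ⇒thy : (χ ∧ₚ lits as v) ⊢ₚ thy v
      χ⇒thy = pair (fst (fst (fst hyp))) (snd hyp)
      u : World
      u = world v (consistent-mono χ⇒thy v-consistent)
      sub : ∀ {b} → □ₚ b ∈ as → w ⊩ □ₚ b → u ⊩ □ₚ b
      sub j k with decide u j
      ... | inj₁ l = l
      ... | inj₂ l = ⊥-elim (v-consistent (app (l · χ⇒thy) (boxes-∈ w as j k · snd (fst (fst hyp)))))
      u⊩¬a : (u ⊩ a) ⊎ (u ⊩ ¬ₚ a) → u ⊩ ¬ₚ a
      u⊩¬a (inj₂ k) = k
      u⊩¬a (inj₁ k) = ⊥-elim (v-consistent (app (snd (fst hyp)) (k · χ⇒thy)))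

    □-witness : ∀ w {a} → (∀ u → (u ⊩ a) ⊎ (u ⊩ ¬ₚ a)) → □ₚ a ∈ as →
      (w ⊩ □ₚ a) × (∀ u → R w u → u ⊩ a) ⊎ (w ⊩ ¬ₚ (□ₚ a)) × Σ World λ u → R w u × u ⊩ ¬ₚ a
    □-witness w {a} dec i with decide w i
    ... | inj₁ h = inj₁ (h , λ u r → T _ · proj₁ r i h)
    ... | inj₂ h with em₀ {w ≡ τ}
    ... | no w≢τ = inj₂ (h , successor w dec w≢τ h)
    -- Since `τ` sees only itself, the witness has to be `τ`; `τ-box` excludes the case in which it
    -- fails.
    ... | yes w≡τ with dec w
    ... | inj₁ k = ⊥-elim (τ-box (subst (_⊩ a) w≡τ k) (subst (_⊩ ¬ₚ (□ₚ a)) w≡τ h))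
    ... | inj₂ k = inj₂ (h , w , ((λ _ l → l) , λ e → e) , k)

    -- If `τ` refuted a box of `w`, then `◇-top`, applied to the doubled box, would make `w`
    -- inconsistent.
    R-top : ∀ w → R w τ
    R-top w = sub , λ _ → refl
      where
      sub : ∀ {b} → □ₚ b ∈ as → w ⊩ □ₚ b → τ ⊩ □ₚ b
      sub i h with decide τ i
      ... | inj₁ k = k
      ... | inj₂ k = ⊥-elim (true-decided (proj₂ w) (◇-top (fst hyp) k (four _ · h)))

    -- The default `τ` for inconsistent vectors lets the list of all vectors enumerate the worlds.
    toWorld : Vec Bool n → World
    toWorld v with em₀ {Consistent (thy v)}
    ... | yes c = world v c
    ... | no _  = τ

    toWorld-≡ : ∀ w → toWorld (proj₁ w) ≡ w
    toWorld-≡ w with em₀ {Consistent (thy (proj₁ w))}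
    ... | yes _ = World-≡ refl
    ... | no k  = ⊥-elim (k (true-decided (proj₂ w)))

    frame : Frame
    frame = record
      { X = World
      ; R = R
      ; R-refl = (λ _ k → k) , λ e → e
      ; R-trans = λ r s → (λ i h → proj₁ s i (proj₁ r i h)) , λ e → proj₂ s (proj₂ r e)
      ; τ = τ
      ; top = R-top
      ; final = λ r → proj₂ r refl
      ; size = length worlds
      ; enum = List.lookup worlds
      ; enum-index = λ w → index (w∈ w) , sym (lookup-index (w∈ w))
      }
      where
      worlds : List World
      worlds = map toWorld (allVecs n)
      w∈ : ∀ w → w ∈ worlds
      w∈ w = subst (_∈ worlds) (toWorld-≡ w) (∈-map⁺ toWorld (∈-allVecs (proj₁ w)))

    val : World → ℕ → Bool
    val w i = does (em₀ {w ⊩ p i})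

    open Forcing frame val

    Decides : World → PF → Set
    Decides w a = (Forces w a × w ⊩ a) ⊎ ((¬ Forces w a) × w ⊩ ¬ₚ a)

    provability : ∀ {w a} → Decides w a → (w ⊩ a) ⊎ (w ⊩ ¬ₚ a)
    provability (inj₁ (_ , h)) = inj₁ h
    provability (inj₂ (_ , h)) = inj₂ h

    -- Forcing and provability are settled together, because `□-witness` requires the formula under
    -- the box to be decided at every world.
    truth : ∀ a → (∀ {x} → x ∈ base a → x ∈ as) → ∀ w → Decides w a
    truth (p i) s w with decide w (s (here refl))
    ... | inj₁ h = inj₁ (decided-true h , h)
    ... | inj₂ h = inj₂ ((λ e → consistent w (true-decided e) h) , h)
    truth ⊥ₚ s w = inj₂ ((λ ()) , const-⊢ hyp)
    truth (a ⇒ₚ b) s w with truth a (λ i → s (∈-++⁺ˡ i)) w | truth b (λ i → s (∈-++⁺ʳ _ i)) w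
    ... | inj₁ (fa , ha) | inj₁ (fb , hb) = inj₁ ((λ _ → fb) , ⊢-K _ _ · hb)
    ... | inj₁ (fa , ha) | inj₂ (fb , hb) = inj₂ ((λ f → fb (f fa)) ,
          deduce (app (hb · fst hyp) (app (snd hyp) (ha · fst hyp))))
    ... | inj₂ (fa , ha) | _ = inj₁ ((λ f → ⊥-elim (fa f)) ,
          deduce (⊢-efq _ · app (ha · fst hyp) (snd hyp)))
    truth (a ∧ₚ b) s w with truth a (λ i → s (∈-++⁺ˡ i)) w | truth b (λ i → s (∈-++⁺ʳ _ i)) w
    ... | inj₁ (fa , ha) | inj₁ (fb , hb) = inj₁ ((fa , fb) , pair ha hb)
    ... | inj₁ (fa , ha) | inj₂ (fb , hb) = inj₂ ((λ f → fb (proj₂ f)) ,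
          deduce (app (hb · fst hyp) (snd (snd hyp))))
    ... | inj₂ (fa , ha) | _ = inj₂ ((λ f → fa (proj₁ f)) ,
          deduce (app (ha · fst hyp) (fst (snd hyp))))
    truth (a ∨ₚ b) s w with truth a (λ i → s (∈-++⁺ˡ i)) w | truth b (λ i → s (∈-++⁺ʳ _ i)) w
    ... | inj₁ (fa , ha) | _ = inj₁ (inj₁ fa , ⊢-inl _ _ · ha)
    ... | inj₂ _ | inj₁ (fb , hb) = inj₁ (inj₂ fb , ⊢-inr _ _ · hb)
    ... | inj₂ (fa , ha) | inj₂ (fb , hb) =
          inj₂ ((λ { (inj₁ f) → fa f ; (inj₂ f) → fb f }) , app (⊢-case _ _ · ha) hb)
    truth (□ₚ a) s w with □-witness w (λ u → provability (truth a (λ i → s (there i)) u)) (s (here refl))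
    ... | inj₁ (h , all) = inj₁ (forced , h)
      where
      forced : ∀ u → R w u → Forces u a
      forced u r with truth a (λ i → s (there i)) u
      ... | inj₁ (f , _) = f
      ... | inj₂ (_ , k) = ⊥-elim (consistent u (all u r) k)
    ... | inj₂ (h , u , r , k) = inj₂ (refuted , h)
      where
      refuted : ¬ Forces w (□ₚ a)
      refuted f with truth a (λ i → s (there i)) u
      ... | inj₁ (_ , l) = consistent u l k
      ... | inj₂ (g , _) = g (f u r)
    -- `base` records `□ₚ (¬ₚ a)` for a diamond, so the witness is sought for that box.
    truth (◇ₚ a) s w with □-witness w {¬ₚ a} negated (s (here refl))
      where
      negated : ∀ u → (u ⊩ ¬ₚ a) ⊎ (u ⊩ ¬ₚ (¬ₚ a))
      negated u with truth a (λ i → s (there i)) u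
      ... | inj₁ (_ , h) = inj₂ (deduce (app (snd hyp) (h · fst hyp)))
      ... | inj₂ (_ , h) = inj₁ h
    ... | inj₁ (h , all) = inj₂ (refuted , deduce (app (dual₁ _ · snd hyp) (h · fst hyp)))
      where
      refuted : ¬ Forces w (◇ₚ a)
      refuted (u , r , f) with truth a (λ i → s (there i)) u
      ... | inj₁ (_ , k) = consistent u k (all u r)
      ... | inj₂ (g , _) = g f
    ... | inj₂ (h , u , r , k) = inj₁ (forced , dual₂ _ · h)
      where
      forced : Forces w (◇ₚ a)
      forced with truth a (λ i → s (there i)) u
      ... | inj₁ (f , _) = u , r , f
      ... | inj₂ (_ , l) = ⊥-elim (consistent u l k)

    root : World
    root = world (proj₁ l) (consistent-mono (pair (snd (fst hyp)) (snd hyp)) (proj₂ l))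
      where l = lindenbaum as γ-consistent

    root-refutes : ¬ Forces root ψ
    root-refutes f with truth ψ (λ i → i) root
    ... | inj₁ (_ , h) = proj₂ (lindenbaum as γ-consistent)
          (app (fst (fst hyp)) (h · pair (snd (fst hyp)) (snd hyp)))
    ... | inj₂ (k , _) = k f

-- Soundness

record Iso (U V : LO) : Set where
  field
    fwd      : Cond U V
    bwd    : Cond V U
    fwd-bwd : ∀ v → fun fwd (fun bwd v) ≡ v
    bwd-fwd : ∀ u → fun bwd (fun fwd u) ≡ u

open Iso

id-iso : ∀ {U} → Iso U U
id-iso {U} = record { fwd = idC U ; bwd = idC U ; fwd-bwd = λ _ → refl ; bwd-fwd = λ _ → refl }

sym-iso : ∀ {U V} → Iso U V → Iso V U
sym-iso i = record { fwd = bwd i ; bwd = fwd i ; fwd-bwd = bwd-fwd i ; bwd-fwd = fwd-bwd i }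

flip-≡ : ∀ {U V} (i : Iso U V) {u v} → fun (fwd i) u ≡ v → fun (bwd i) v ≡ u
flip-≡ i e = trans (cong (fun (bwd i)) (sym e)) (bwd-fwd i _)

-- Condensations out of `U` and `V` correspond by composition and keep their targets, so the modal
-- cases reduce to pointwise equal maps. Implication needs the inverse direction.
Sat-iso : ∀ {W U V n} (i : Iso U V) {g : Cond W U} {h : Cond W V}
  {ν : Fin n → Carrier U} {μ : Fin n → Carrier V} →
  (∀ w → fun (fwd i) (fun g w) ≡ fun h w) → (∀ k → fun (fwd i) (ν k) ≡ μ k) →
  ∀ φ → Sat U g ν φ → Sat V h μ φ
Sat-iso {W} {U} {V} {n} i {g} {h} {ν} {μ} e e′ = go
  where
  term : ∀ s → fun (fwd i) (⟦ s ⟧ g ν) ≡ ⟦ s ⟧ h μ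
  term (var k)   = e′ k
  term (const w) = e w
  ext : ∀ {a b} → fun (fwd i) a ≡ b → ∀ k → fun (fwd i) (extend a ν k) ≡ extend b μ k
  ext q zero    = q
  ext q (suc k) = e′ k
  go : ∀ φ → Sat U g ν φ → Sat V h μ φ
  go (s ≤' t) (lift q) = lift (subst₂ (V ⊢_≤_) (term s) (term t) (Cond.monotone (fwd i) q))
  go (s ≐ t) (lift q) = lift (trans (sym (term s)) (trans (cong (fun (fwd i)) q) (term t)))
  go (φ ⇒ ψ) q x = go ψ (q (Sat-iso (sym-iso i) (λ w → flip-≡ i (e w)) (λ k → flip-≡ i (e′ k)) φ x))
  go (φ ∧' ψ) (x , y) = go φ x , go ψ y
  go (φ ∨' ψ) (inj₁ x) = inj₁ (go φ x)
  go (φ ∨' ψ) (inj₂ y) = inj₂ (go ψ y)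
  go (∀' φ) q a = Sat-iso i e (ext (fwd-bwd i a)) φ (q (fun (bwd i) a))
  go (∃' φ) (lift a , x) = lift (fun (fwd i) a) , Sat-iso i e (ext refl) φ x
  go (□' φ) q X f = Sat-iso id-iso (λ w → cong (fun f) (e w)) (λ k → cong (fun f) (e′ k)) φ (q X (f ∘C fwd i))
  go (◇' φ) (X , f , x) = X , (f ∘C bwd i) ,
    Sat-iso id-iso (λ w → cong (fun f) (sym (flip-≡ i (e w)))) (λ k → cong (fun f) (sym (flip-≡ i (e′ k)))) φ x

-- Composites that agree pointwise may differ in their surjectivity proofs; satisfaction sees only
-- the underlying maps.
Sat-cong : ∀ {W U n} {g h : Cond W U} {ν μ : Fin n → Carrier U} →
  (∀ w → fun g w ≡ fun h w) → (∀ k → ν k ≡ μ k) → ∀ φ → Sat U g ν φ → Sat U h μ φ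
Sat-cong = Sat-iso id-iso

𝟙 : LO
𝟙 = record
  { Carrier = ⊤
  ; _≤_ = λ _ _ → ⊤
  ; isTotalOrder = record
    { isPartialOrder = record
      { isPreorder = record { isEquivalence = isEquivalence ; reflexive = λ _ → tt ; trans = λ _ _ → tt }
      ; antisym = λ _ _ → refl }
    ; total = λ _ _ → inj₁ tt }
  ; inhabitant = tt
  }

! : ∀ U → Cond U 𝟙
! U = record { fun = λ _ → tt ; monotone = λ _ → tt ; surjective = λ _ → LO.inhabitant U , refl }

Singleton : LO → Set
Singleton U = (x y : Carrier U) → x ≡ y

image-singleton : ∀ {U V} → Cond U V → Singleton U → Singleton V
image-singleton f s x y with Cond.surjective f x | Cond.surjective f y
... | u , refl | v , refl = cong (fun f) (s u v)

singleton-iso : ∀ {U V} → Cond U V → Singleton U → Iso U V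
singleton-iso {U} {V} f s = record
  { fwd = f
  ; bwd = record
    { fun = λ _ → LO.inhabitant U
    ; monotone = λ _ → IsTotalOrder.refl (LO.isTotalOrder U)
    ; surjective = λ u → LO.inhabitant V , s _ _ }
  ; fwd-bwd = λ v → image-singleton f s _ _
  ; bwd-fwd = λ u → s _ _
  }

module Soundness (em : ExcludedMiddle (lsuc 0ℓ)) where

  -- By excluded middle, satisfaction gives a Boolean valuation of atoms and modal formulas, and
  -- `evalB` computes satisfaction from it.
  taut-sound : ∀ {W U} (g : Cond W U) (ν : Fin 0 → Carrier U) (σ : ℕ → Sentence W) {a} →
    Taut a → Sat U g ν (inst σ a)
  taut-sound {W} {U} g ν σ {a} t with sound a
    where
    v : PF → Bool
    v a = does (em {Sat U g ν (inst σ a)})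
    Agrees : PF → Bool → Set₁
    Agrees a b = (b ≡ true × Sat U g ν (inst σ a)) ⊎ (b ≡ false × ¬ Sat U g ν (inst σ a))
    atom : ∀ a → Agrees a (v a)
    atom a with em {Sat U g ν (inst σ a)}
    ... | yes s = inj₁ (refl , s)
    ... | no k  = inj₂ (refl , k)
    sound : ∀ a → Agrees a (evalB v a)
    sound (p i) = atom (p i)
    sound ⊥ₚ = inj₂ (refl , λ ())
    sound (a ⇒ₚ b) with evalB v a | sound a | evalB v b | sound b
    ... | _ | inj₁ (refl , x) | _ | inj₁ (refl , y) = inj₁ (refl , λ _ → y)
    ... | _ | inj₁ (refl , x) | _ | inj₂ (refl , y) = inj₂ (refl , λ f → y (f x))
    ... | _ | inj₂ (refl , x) | _ | _ = inj₁ (refl , λ z → ⊥-elim (x z))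
    sound (a ∧ₚ b) with evalB v a | sound a | evalB v b | sound b
    ... | _ | inj₁ (refl , x) | _ | inj₁ (refl , y) = inj₁ (refl , x , y)
    ... | _ | inj₁ (refl , x) | _ | inj₂ (refl , y) = inj₂ (refl , λ f → y (proj₂ f))
    ... | _ | inj₂ (refl , x) | _ | _ = inj₂ (refl , λ f → x (proj₁ f))
    sound (a ∨ₚ b) with evalB v a | sound a | evalB v b | sound b
    ... | _ | inj₁ (refl , x) | _ | _ = inj₁ (refl , inj₁ x)
    ... | _ | inj₂ (refl , x) | _ | inj₁ (refl , y) = inj₁ (refl , inj₂ y)
    ... | _ | inj₂ (refl , x) | _ | inj₂ (refl , y) = inj₂ (refl , λ { (inj₁ z) → x z ; (inj₂ z) → y z })
    sound (□ₚ a) = atom (□ₚ a)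
    sound (◇ₚ a) = atom (◇ₚ a)
  ... | inj₁ (_ , s) = s
  ... | inj₂ (e , _) with trans (sym (t _)) e
  ... | ()

  -- Stated for all `U` below `W`, so that `nec` can evaluate the same derivation at another world.
  soundness : ∀ {W U} (g : Cond W U) (ν : Fin 0 → Carrier U) (σ : ℕ → Sentence W) {a} →
    S4∙2∙1 a → Sat U g ν (inst σ a)
  soundness g ν σ (taut {a} t) = taut-sound g ν σ {a} t
  soundness g ν σ (K a b) f x V h = f V h (x V h)
  soundness g ν σ (dual₁ a) (V , h , x) f = f V h x
  soundness {U = U} g ν σ (dual₂ a) f with em {Sat U g ν (inst σ (◇ₚ a))}
  ... | yes s = s
  ... | no k  = ⊥-elim (lower (f λ V h x → lift (k (V , h , x))))
  -- For reflexivity and transitivity, identity and composition of condensations suffice, up to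
  -- pointwise equality.
  soundness {U = U} g ν σ (T a) f = Sat-cong (λ _ → refl) (λ _ → refl) (inst σ a) (f U (idC U))
  soundness g ν σ (four a) f V h V′ h′ = Sat-cong (λ _ → refl) (λ _ → refl) (inst σ a) (f V′ (h′ ∘C h))
  soundness g ν σ (dot2 a) (V , h , f) V′ h′ = 𝟙 , ! V′ ,
    Sat-cong (λ _ → refl) (λ _ → refl) (inst σ a) (f 𝟙 (! V))
  -- A world seen from `𝟙` is a singleton, and every condensation out of it is an isomorphism; what
  -- holds there holds forever.
  soundness {U = U} g ν σ (dot1 a) f with f 𝟙 (! U)
  ... | V , h , x = V , (h ∘C ! U) , λ V′ h′ →
        Sat-iso (singleton-iso h′ (image-singleton h λ _ _ → refl)) (λ _ → refl) (λ _ → refl) (inst σ a) x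
  soundness g ν σ (mp d d′) = soundness g ν σ d (soundness g ν σ d′)
  soundness g ν σ (nec d) V h = soundness (h ∘C g) (λ k → fun h (ν k)) σ d

-- Constructing condensations

module _ (U : LO) where
  open IsTotalOrder (LO.isTotalOrder U)
    renaming (refl to ≤-refl′; trans to ≤-trans′; antisym to ≤-antisym′; total to ≤-total′)

  ≤-refl : ∀ {x} → U ⊢ x ≤ x
  ≤-refl = ≤-refl′

  ≤-trans : ∀ {x y z} → U ⊢ x ≤ y → U ⊢ y ≤ z → U ⊢ x ≤ z
  ≤-trans = ≤-trans′

  ≤-antisym : ∀ {x y} → U ⊢ x ≤ y → U ⊢ y ≤ x → x ≡ y
  ≤-antisym = ≤-antisym′

  ≤-total : ∀ x y → (U ⊢ x ≤ y) ⊎ (U ⊢ y ≤ x)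
  ≤-total = ≤-total′

  <⇒≱ : ∀ {x y} → U ⊢ x < y → ¬ (U ⊢ y ≤ x)
  <⇒≱ (x≤y , x≢y) y≤x = x≢y (≤-antisym x≤y y≤x)

  <-≤-trans : ∀ {x y z} → U ⊢ x < y → U ⊢ y ≤ z → U ⊢ x < z
  <-≤-trans x<y y≤z = ≤-trans (proj₁ x<y) y≤z , λ { refl → <⇒≱ x<y y≤z }

  ≤-<-trans : ∀ {x y z} → U ⊢ x ≤ y → U ⊢ y < z → U ⊢ x < z
  ≤-<-trans x≤y y<z = ≤-trans x≤y (proj₁ y<z) , λ { refl → <⇒≱ y<z x≤y }

  ≰⇒> : ∀ {x y} → ¬ (U ⊢ x ≤ y) → U ⊢ y < x
  ≰⇒> {x} {y} x≰y with ≤-total x y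
  ... | inj₁ x≤y = ⊥-elim (x≰y x≤y)
  ... | inj₂ y≤x = y≤x , λ { refl → x≰y ≤-refl }

  Succ : Carrier U → Carrier U → Set
  Succ x y = (U ⊢ x < y) × (∀ z → U ⊢ x < z → U ⊢ y ≤ z)

  Succ-unique : ∀ {x y z} → Succ x y → Succ x z → y ≡ z
  Succ-unique (x<y , y-least) (x<z , z-least) = ≤-antisym (y-least _ x<z) (z-least _ x<y)

  -- A greatest element counts as a limit in this sense.
  Lim : Carrier U → Set
  Lim x = ∀ y → ¬ Succ x y

  LimBelow : Carrier U → Set
  LimBelow d = ∀ x → U ⊢ x < d → Σ (Carrier U) λ b → (U ⊢ x < b) × (U ⊢ b < d) × Lim b

  Chain : ℕ → Carrier U → Set
  Chain zero    x = ⊤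
  Chain (suc i) x = Σ (Carrier U) λ y → Succ x y × Chain i y

module _ {U V : LO} (f : Cond U V) where

  reflect-< : ∀ {x y} → V ⊢ fun f x < fun f y → U ⊢ x < y
  reflect-< fx<fy = ≰⇒> U λ y≤x → <⇒≱ V fx<fy (Cond.monotone f y≤x)

  preserve-< : ∀ {x y} → U ⊢ x < y → fun f x ≢ fun f y → V ⊢ fun f x < fun f y
  preserve-< x<y ne = Cond.monotone f (proj₁ x<y) , ne

-- `E` lists only the intended identifications; `kernel` adds the diagonal.
record Collapse (U : LO) (E : Carrier U → Carrier U → Set) : Set₁ where
  field
    V      : LO
    f      : Cond U V
    glue   : ∀ {x y} → E x y → fun f x ≡ fun f y
    kernel : ∀ {x y} → fun f x ≡ fun f y → x ≡ y ⊎ E x y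

module Constructions (em : ExcludedMiddle (lsuc 0ℓ)) where
  open Classical em using (em₀)

  ≤⊎> : ∀ U x y → (U ⊢ x ≤ y) ⊎ (U ⊢ y < x)
  ≤⊎> U x y with em₀ {U ⊢ x ≤ y}
  ... | yes h = inj₁ h
  ... | no k  = inj₂ (≰⇒> U k)

  upper-bound< : ∀ U {x y d} → U ⊢ x < d → U ⊢ y < d →
    Σ (Carrier U) λ m → (U ⊢ x ≤ m) × (U ⊢ y ≤ m) × (U ⊢ m < d)
  upper-bound< U {x} {y} x<d y<d with ≤-total U x y
  ... | inj₁ x≤y = y , x≤y , ≤-refl U , y<d
  ... | inj₂ y≤x = x , ≤-refl U , y≤x , x<d

  -- C x z means that z is the representative of the class of x; points without a
  -- representative stay fixed.  In the absence of quotient types the target consists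
  -- of the fixed points of the resulting idempotent.
  module _ (U : LO) (C : Carrier U → Carrier U → Set)
    (C-rep : ∀ {x z} → C x z → C z z)
    (C-mono : ∀ {x y z w} → C x z → C y w → U ⊢ x ≤ y → U ⊢ z ≤ w)
    (C-convexˡ : ∀ {x y z} → C x z → U ⊢ x ≤ y → U ⊢ y ≤ z → C y z)
    (C-convexʳ : ∀ {x y z} → C x z → U ⊢ z ≤ y → U ⊢ y ≤ x → C y z) where

    private
      Rep : Carrier U → Carrier U → Set
      Rep x z = C x z ⊎ ((∀ w → ¬ C x w) × z ≡ x)

      rep : ∀ x → Σ (Carrier U) (Rep x)
      rep x with em₀ {Σ (Carrier U) (C x)}
      ... | yes (z , c) = z , inj₁ c
      ... | no k        = x , inj₂ ((λ w c → k (w , c)) , refl)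

      -- By convexity a point outside all classes cannot lie between a point and its representative.
      Rep-mono : ∀ {x y z w} → Rep x z → Rep y w → U ⊢ x ≤ y → U ⊢ z ≤ w
      Rep-mono (inj₁ c) (inj₁ c′) x≤y = C-mono c c′ x≤y
      Rep-mono {y = y} {z} (inj₁ c) (inj₂ (k , refl)) x≤y with ≤-total U z y
      ... | inj₁ z≤y = z≤y
      ... | inj₂ y≤z = ⊥-elim (k z (C-convexˡ c x≤y y≤z))
      Rep-mono {x} {w = w} (inj₂ (k , refl)) (inj₁ c) x≤y with ≤-total U x w
      ... | inj₁ x≤w = x≤w
      ... | inj₂ w≤x = ⊥-elim (k w (C-convexʳ c w≤x x≤y))
      Rep-mono (inj₂ (_ , refl)) (inj₂ (_ , refl)) x≤y = x≤y

      Rep-unique : ∀ {x z w} → Rep x z → Rep x w → z ≡ w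
      Rep-unique s t = ≤-antisym U (Rep-mono s t (≤-refl U)) (Rep-mono t s (≤-refl U))

      Rep-rep : ∀ {x z} → Rep x z → Rep z z
      Rep-rep (inj₁ c)          = inj₁ (C-rep c)
      Rep-rep (inj₂ (k , refl)) = inj₂ (k , refl)

      r : Carrier U → Carrier U
      r x = proj₁ (rep x)

      r-idem : ∀ x → r (r x) ≡ r x
      r-idem x = Rep-unique (proj₂ (rep (r x))) (Rep-rep (proj₂ (rep x)))

      Fixed : Set
      Fixed = Σ (Carrier U) λ x → r x ≡ x

      Fixed-≡ : {x y : Fixed} → proj₁ x ≡ proj₁ y → x ≡ y
      Fixed-≡ {x , e} {.x , e′} refl = cong (x ,_) (uip e e′)

      quotient : LO
      quotient = record
        { Carrier = Fixed
        ; _≤_ = λ x y → U ⊢ proj₁ x ≤ proj₁ y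
        ; isTotalOrder = record
          { isPartialOrder = record
            { isPreorder = record
              { isEquivalence = isEquivalence
              ; reflexive = λ { refl → ≤-refl U }
              ; trans = ≤-trans U }
            ; antisym = λ h k → Fixed-≡ (≤-antisym U h k) }
          ; total = λ x y → ≤-total U (proj₁ x) (proj₁ y) }
        ; inhabitant = r (LO.inhabitant U) , r-idem _
        }

      π : Cond U quotient
      π = record
        { fun = λ x → r x , r-idem x
        ; monotone = λ {x} {y} → Rep-mono (proj₂ (rep x)) (proj₂ (rep y))
        ; surjective = λ v → proj₁ v , Fixed-≡ (proj₂ v)
        }

      π-kernel : ∀ {x y} → fun π x ≡ fun π y → x ≡ y ⊎ Σ (Carrier U) λ z → C x z × C y z
      π-kernel {x} {y} e = go (proj₂ (rep x)) (proj₂ (rep y)) (cong proj₁ e)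
        where
        go : ∀ {z w} → Rep x z → Rep y w → z ≡ w → x ≡ y ⊎ Σ (Carrier U) λ z → C x z × C y z
        go (inj₁ c) (inj₁ c′) refl = inj₂ (_ , c , c′)
        go (inj₁ c) (inj₂ (k , refl)) refl = ⊥-elim (k _ (C-rep c))
        go (inj₂ (k , refl)) (inj₁ c) refl = ⊥-elim (k _ (C-rep c))
        go (inj₂ (_ , refl)) (inj₂ (_ , refl)) refl = inj₁ refl

    abstract
      collapse : Collapse U (λ x y → Σ (Carrier U) λ z → C x z × C y z)
      collapse = record
        { V = quotient
        ; f = π
        ; glue = λ (z , c , c′) → Fixed-≡
            (trans (Rep-unique (proj₂ (rep _)) (inj₁ c)) (Rep-unique (inj₁ c′) (proj₂ (rep _))))
        ; kernel = π-kernel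
        }

  abstract
    collapse-convex : ∀ U (P : Carrier U → Set) {z₀} → P z₀ →
      (∀ {x y z} → P x → P z → U ⊢ x ≤ y → U ⊢ y ≤ z → P y) → Collapse U (λ x y → P x × P y)
    collapse-convex U P {z₀} Pz₀ convex = record
      { V = V ; f = f
      ; glue = λ (Px , Py) → glue (z₀ , (Px , refl) , (Py , refl))
      ; kernel = λ e → [ inj₁ , (λ (_ , (Px , _) , (Py , _)) → inj₂ (Px , Py)) ]′ (kernel e) }
      where
      q : Collapse U (λ x y → Σ (Carrier U) λ z → (P x × z ≡ z₀) × (P y × z ≡ z₀))
      q = collapse U (λ x z → P x × z ≡ z₀)
        (λ { (_ , refl) → Pz₀ , refl })
        (λ { (_ , refl) (_ , refl) _ → ≤-refl U })
        (λ { (Px , refl) x≤y y≤z → convex Px Pz₀ x≤y y≤z , refl })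
        (λ { (Px , refl) z≤y y≤x → convex Pz₀ Px z≤y y≤x , refl })
      open Collapse q

  -- Above h nothing changes, so limits above h remain limits.
  LimBelow-collapse : ∀ {U E h d} (c : Collapse U E) → let open Collapse c in
    (∀ {x y} → E x y → (U ⊢ x ≤ h) × (U ⊢ y ≤ h)) → U ⊢ h < d → LimBelow U d → LimBelow V (fun f d)
  LimBelow-collapse {U} {E} {h} {d} c E≤h h<d lim v v<fd with Cond.surjective (Collapse.f c) v
  ... | x , refl = fun f b , f-< x<b (<⇒≱ U h<b) , f-< b<d (<⇒≱ U h<d) , b-lim′
    where
    open Collapse c
    f-< : ∀ {x y} → U ⊢ x < y → ¬ (U ⊢ y ≤ h) → V ⊢ fun f x < fun f y
    f-< x<y y≰h = preserve-< f x<y λ e → [ proj₂ x<y , (λ q → y≰h (proj₂ (E≤h q))) ]′ (kernel e)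
    m = upper-bound< U (reflect-< f v<fd) h<d
    l = lim (proj₁ m) (proj₂ (proj₂ (proj₂ m)))
    b : Carrier U
    b = proj₁ l
    x<b : U ⊢ x < b
    x<b = ≤-<-trans U (proj₁ (proj₂ m)) (proj₁ (proj₂ l))
    h<b : U ⊢ h < b
    h<b = ≤-<-trans U (proj₁ (proj₂ (proj₂ m))) (proj₁ (proj₂ l))
    b<d : U ⊢ b < d
    b<d = proj₁ (proj₂ (proj₂ l))
    b-lim′ : Lim V (fun f b)
    b-lim′ y′ (b<y′ , least) with Cond.surjective f y′
    ... | y , refl = proj₂ (proj₂ (proj₂ l)) y (reflect-< f b<y′ , below)
      where
      below : ∀ z → U ⊢ b < z → U ⊢ y ≤ z
      below z b<z with ≤⊎> U y z
      ... | inj₁ y≤z = y≤z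
      ... | inj₂ z<y = ⊥-elim (<⇒≱ V
            (f-< z<y λ y≤h → <⇒≱ U (≤-<-trans U y≤h h<b) (proj₁ (reflect-< f b<y′)))
            (least (fun f z) (f-< b<z λ z≤h → <⇒≱ U h<b (≤-trans U (proj₁ b<z) z≤h))))

  -- `injective` protects the buttons, all of which lie at or below `c`; the last two fields keep
  -- the dial usable.
  record Extension (U : LO) (c d : Carrier U) : Set₁ where
    field
      V         : LO
      f         : Cond U V
      injective : ∀ {x y} → U ⊢ x ≤ c → U ⊢ y ≤ c → fun f x ≡ fun f y → x ≡ y
      c<d       : V ⊢ fun f c < fun f d
      limBelow  : LimBelow V (fun f d)

  Press : (U : LO) (a b c d : Carrier U) → Set₁
  Press U a b c d =
    Σ (Collapse U λ x y → ((U ⊢ a ≤ x) × (U ⊢ x ≤ b)) × ((U ⊢ a ≤ y) × (U ⊢ y ≤ b))) λ q →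
      let open Collapse q in (V ⊢ fun f c < fun f d) × LimBelow V (fun f d)

  -- The glued interval ends at or below `c`, so `c` and `d` stay apart and the limits between them
  -- survive.
  press : ∀ U {a b c d} → U ⊢ a ≤ b → U ⊢ b ≤ c → U ⊢ c < d → LimBelow U d → Press U a b c d
  press U {a} {b} {c} {d} a≤b b≤c c<d lim = q ,
    preserve-< f c<d (λ e → [ proj₂ c<d , (λ (_ , _ , d≤b) → <⇒≱ U c<d (≤-trans U d≤b b≤c)) ]′ (kernel e)) ,
    LimBelow-collapse q (λ ((_ , x≤b) , _ , y≤b) → ≤-trans U x≤b b≤c , ≤-trans U y≤b b≤c) c<d lim
    where
    q : Collapse U λ x y → ((U ⊢ a ≤ x) × (U ⊢ x ≤ b)) × ((U ⊢ a ≤ y) × (U ⊢ y ≤ b))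
    q = collapse-convex U (λ x → (U ⊢ a ≤ x) × (U ⊢ x ≤ b)) (≤-refl U , a≤b)
          (λ (a≤x , _) (_ , z≤b) x≤y y≤z → ≤-trans U a≤x x≤y , ≤-trans U y≤z z≤b)
    open Collapse q

  Dial : ℕ → (U : LO) (c d : Carrier U) → Set₁
  Dial i U c d =
    Σ (Extension U c d) λ x → let open Extension x in Chain V i (fun f c) × ¬ Chain V (suc i) (fun f c)

  -- Induction on `i`. For zero, glue `c` to a limit `b`. Otherwise glue only the points after `c`
  -- up to `b`, which makes `b` the successor of `c`, and set the remaining length from `b` on.
  dial : ∀ i U {c d} → U ⊢ c < d → LimBelow U d → Dial i U c d
  dial zero U {c} {d} c<d lim with lim c c<d
  ... | b , c<b , b<d , b-lim = record
        { V = V ; f = f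
        ; injective = λ x≤c y≤c e → [ (λ x≡y → x≡y) , (λ ((c≤x , _) , c≤y , _) →
            trans (≤-antisym U x≤c c≤x) (≤-antisym U c≤y y≤c)) ]′ (kernel e)
        ; c<d = preserve-< f c<d λ e → [ proj₂ c<d , (λ (_ , _ , d≤b) → <⇒≱ U b<d d≤b) ]′ (kernel e)
        ; limBelow = LimBelow-collapse q (λ ((_ , x≤b) , _ , y≤b) → x≤b , y≤b) b<d lim
        } , tt , λ (y′ , s , _) → c-lim y′ s
    where
    q : Collapse U λ x y → ((U ⊢ c ≤ x) × (U ⊢ x ≤ b)) × ((U ⊢ c ≤ y) × (U ⊢ y ≤ b))
    q = collapse-convex U (λ x → (U ⊢ c ≤ x) × (U ⊢ x ≤ b)) (≤-refl U , proj₁ c<b)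
          (λ (c≤x , _) (_ , z≤b) x≤y y≤z → ≤-trans U c≤x x≤y , ≤-trans U y≤z z≤b)
    open Collapse q
    -- `f` identifies `c` with `b`, and a successor of their class would come from a successor of
    -- `b`.
    c-lim : Lim V (fun f c)
    c-lim y′ (c<y′ , least) with Cond.surjective f y′
    ... | y , refl = b-lim y (b<y , below)
      where
      c<y : U ⊢ c < y
      c<y = reflect-< f c<y′
      b<y : U ⊢ b < y
      b<y = ≰⇒> U λ y≤b → proj₂ c<y′ (glue ((≤-refl U , proj₁ c<b) , (proj₁ c<y , y≤b)))
      below : ∀ z → U ⊢ b < z → U ⊢ y ≤ z
      below z b<z with ≤⊎> U y z
      ... | inj₁ y≤z = y≤z
      ... | inj₂ z<y = ⊥-elim (<⇒≱ V
            (preserve-< f z<y λ e → [ proj₂ z<y , (λ ((_ , z≤b) , _) → <⇒≱ U b<z z≤b) ]′ (kernel e))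
            (least (fun f z) (preserve-< f (≤-<-trans U (proj₁ c<b) b<z)
              λ e → [ (λ { refl → <⇒≱ U b<z (proj₁ c<b) }) , (λ (_ , _ , z≤b) → <⇒≱ U b<z z≤b) ]′ (kernel e))))
  dial (suc i) U {c} {d} c<d lim with lim c c<d
  ... | b , c<b , b<d , b-lim = record
        { V = V₂ ; f = f₂ ∘C f
        ; injective = λ x≤c y≤c e → inj x≤c y≤c
            (injective (Cond.monotone f (≤-trans U x≤c (proj₁ c<b))) (Cond.monotone f (≤-trans U y≤c (proj₁ c<b))) e)
        ; c<d = ≤-<-trans V₂ (Cond.monotone f₂ (Cond.monotone f (proj₁ c<b))) c<d₂
        ; limBelow = limBelow
        } , (fun f₂ (fun f b) , c⋖b , proj₁ (proj₂ rest)) ,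
        -- Successors are unique, so every longer chain from `c` passes through the image of `b`.
        λ (y , s , ch) → proj₂ (proj₂ rest) (subst (Chain V₂ (suc i)) (Succ-unique V₂ s c⋖b) ch)
    where
    q : Collapse U λ x y → ((U ⊢ c < x) × (U ⊢ x ≤ b)) × ((U ⊢ c < y) × (U ⊢ y ≤ b))
    q = collapse-convex U (λ x → (U ⊢ c < x) × (U ⊢ x ≤ b)) (c<b , ≤-refl U)
          (λ (c<x , _) (_ , z≤b) x≤y y≤z → <-≤-trans U c<x x≤y , ≤-trans U y≤z z≤b)
    open Collapse q
    inj : ∀ {x y} → U ⊢ x ≤ c → U ⊢ y ≤ c → fun f x ≡ fun f y → x ≡ y
    inj x≤c y≤c e = [ (λ x≡y → x≡y) , (λ ((c<x , _) , _) → ⊥-elim (<⇒≱ U c<x x≤c)) ]′ (kernel e)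
    rest : Dial i V (fun f b) (fun f d)
    rest = dial i V {fun f b} {fun f d}
      (preserve-< f b<d λ e → [ proj₂ b<d , (λ (_ , _ , d≤b) → <⇒≱ U b<d d≤b) ]′ (kernel e))
      (LimBelow-collapse q (λ ((_ , x≤b) , _ , y≤b) → x≤b , y≤b) b<d lim)
    open Extension (proj₁ rest) renaming (V to V₂; f to f₂; c<d to c<d₂)
    fc<fb : V ⊢ fun f c < fun f b
    fc<fb = preserve-< f c<b λ e → [ proj₂ c<b , (λ ((c<c , _) , _) → proj₂ c<c refl) ]′ (kernel e)
    c⋖b : Succ V₂ (fun f₂ (fun f c)) (fun f₂ (fun f b))
    c⋖b = preserve-< f₂ fc<fb (λ e → proj₂ fc<fb (injective (proj₁ fc<fb) (≤-refl V) e)) , least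
      where
      least : ∀ z → V₂ ⊢ fun f₂ (fun f c) < z → V₂ ⊢ fun f₂ (fun f b) ≤ z
      least z c<z with Cond.surjective (f₂ ∘C f) z
      ... | z₀ , refl with ≤-total U b z₀
      ... | inj₁ b≤z = Cond.monotone (f₂ ∘C f) b≤z
      ... | inj₂ z≤b = subst (V₂ ⊢ _ ≤_) (cong (fun f₂) (glue ((c<b , ≤-refl U) , (reflect-< (f₂ ∘C f) c<z , z≤b))))
                         (≤-refl V₂)

  -- g may identify points below c; applying it between c and d only avoids this.
  localise : ∀ {U c d W} (g : Cond U W) → U ⊢ c ≤ d → W ⊢ fun g c < fun g d → LimBelow W (fun g d) → Extension U c d
  localise {U} {c} {d} {W} g c≤d gc<gd lim = record
    { V = V ; f = f
    ; injective = λ x≤c y≤c e → [ (λ x≡y → x≡y) , (λ (_ , (c≤x , _) , c≤y , _) →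
        trans (≤-antisym U x≤c c≤x) (≤-antisym U c≤y y≤c)) ]′ (kernel e)
    ; c<d = f-< gc<gd
    ; limBelow = lim′
    }
    where
    -- The section of `g` is fixed at the two end points, so that representatives of points between
    -- `c` and `d` stay between them.
    S : Carrier W → Carrier U → Set
    S w x = fun g x ≡ w × (w ≡ fun g c → x ≡ c) × (w ≡ fun g d → x ≡ d)
    section : ∀ w → Σ (Carrier U) (S w)
    section w with em₀ {w ≡ fun g c} | em₀ {w ≡ fun g d}
    ... | yes refl | _        = c , refl , (λ _ → refl) , λ e → ⊥-elim (proj₂ gc<gd e)
    ... | no k     | yes refl = d , refl , (λ e → ⊥-elim (k e)) , λ _ → refl
    ... | no k     | no k′    = proj₁ (Cond.surjective g w) , proj₂ (Cond.surjective g w) ,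
                                (λ e → ⊥-elim (k e)) , λ e → ⊥-elim (k′ e)
    κ : Carrier W → Carrier U
    κ w = proj₁ (section w)
    gκ : ∀ w → fun g (κ w) ≡ w
    gκ w = proj₁ (proj₂ (section w))
    κ-mono : ∀ {w w′} → W ⊢ w ≤ w′ → U ⊢ κ w ≤ κ w′
    κ-mono {w} {w′} h with ≤-total U (κ w) (κ w′)
    ... | inj₁ k = k
    ... | inj₂ k with ≤-antisym W h (subst₂ (W ⊢_≤_) (gκ w′) (gκ w) (Cond.monotone g k))
    ... | refl = ≤-refl U
    κ-< : ∀ {w x} → W ⊢ w < fun g x → U ⊢ κ w < x
    κ-< {w} h = reflect-< g (subst (W ⊢_< _) (sym (gκ w)) h)
    <-κ : ∀ {w x} → W ⊢ fun g x < w → U ⊢ x < κ w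
    <-κ {w} h = reflect-< g (subst (W ⊢ _ <_) (sym (gκ w)) h)
    c≤κ : ∀ {x} → U ⊢ c ≤ x → U ⊢ c ≤ κ (fun g x)
    c≤κ {x} h = subst (U ⊢_≤ κ (fun g x)) (proj₁ (proj₂ (proj₂ (section (fun g c)))) refl) (κ-mono (Cond.monotone g h))
    κ≤d : ∀ {x} → U ⊢ x ≤ d → U ⊢ κ (fun g x) ≤ d
    κ≤d {x} h = subst (U ⊢ κ (fun g x) ≤_) (proj₂ (proj₂ (proj₂ (section (fun g d)))) refl) (κ-mono (Cond.monotone g h))

    C : Carrier U → Carrier U → Set
    C x z = (U ⊢ c ≤ x) × (U ⊢ x ≤ d) × z ≡ κ (fun g x)
    q : Collapse U (λ x y → Σ (Carrier U) λ z → C x z × C y z)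
    q = collapse U C
      (λ { {x} (c≤x , x≤d , refl) → c≤κ c≤x , κ≤d x≤d , cong κ (sym (gκ (fun g x))) })
      (λ { (_ , _ , refl) (_ , _ , refl) x≤y → κ-mono (Cond.monotone g x≤y) })
      (λ { {x} {y} (c≤x , x≤d , refl) x≤y y≤z → ≤-trans U c≤x x≤y , ≤-trans U y≤z (κ≤d x≤d) ,
           cong κ (≤-antisym W (Cond.monotone g x≤y) (subst (W ⊢ fun g y ≤_) (gκ (fun g x)) (Cond.monotone g y≤z))) })
      (λ { {x} {y} (c≤x , x≤d , refl) z≤y y≤x → ≤-trans U (c≤κ c≤x) z≤y , ≤-trans U y≤x x≤d ,
           cong κ (≤-antisym W (subst (W ⊢_≤ fun g y) (gκ (fun g x)) (Cond.monotone g z≤y)) (Cond.monotone g y≤x)) })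
    open Collapse q

    κ-injective : ∀ {w w′} → κ w ≡ κ w′ → w ≡ w′
    κ-injective {w} {w′} e = trans (sym (gκ w)) (trans (cong (fun g) e) (gκ w′))
    f-< : ∀ {x y} → W ⊢ fun g x < fun g y → V ⊢ fun f x < fun f y
    f-< gx<gy = preserve-< f (reflect-< g gx<gy) λ e → proj₂ gx<gy
      ([ cong (fun g) , (λ { (_ , (_ , _ , refl) , (_ , _ , e′)) → κ-injective e′ }) ]′ (kernel e))
    g-< : ∀ {x y} → U ⊢ c ≤ x → U ⊢ x ≤ d → U ⊢ c ≤ y → U ⊢ y ≤ d → V ⊢ fun f x < fun f y → W ⊢ fun g x < fun g y
    g-< c≤x x≤d c≤y y≤d fx<fy = preserve-< g (reflect-< f fx<fy) λ e → proj₂ fx<fy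
      (glue (_ , (c≤x , x≤d , refl) , (c≤y , y≤d , cong κ e)))

    lim′ : LimBelow V (fun f d)
    lim′ v v<fd with Cond.surjective f v
    -- Replace `x` by the larger of `x` and `c`: between `c` and `d` the strict orders of `V` and
    -- `W` correspond.
    ... | x , refl with x′
      where
      x′ : Σ (Carrier U) λ x′ → (U ⊢ x ≤ x′) × (U ⊢ c ≤ x′) × (U ⊢ x′ ≤ d) × (W ⊢ fun g x′ < fun g d)
      x′ with ≤-total U c x
      ... | inj₁ c≤x = x , ≤-refl U , c≤x , x≤d , g-< c≤x x≤d c≤d (≤-refl U) v<fd
        where
        x≤d : U ⊢ x ≤ d
        x≤d = proj₁ (reflect-< f v<fd)
      ... | inj₂ x≤c = c , x≤c , ≤-refl U , c≤d , gc<gd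
    ... | x′ , x≤x′ , c≤x′ , x′≤d , gx′<gd with lim (fun g x′) gx′<gd
    ... | b , gx′<b , b<gd , b-lim with κ b | gκ b | <-κ gx′<b | κ-< b<gd
    ... | b̂ | refl | x′<b̂ | b̂<d = fun f b̂ ,
          ≤-<-trans V (Cond.monotone f x≤x′) (f-< gx′<b) ,
          fb̂<fd , b̂-lim
      where
      c≤b̂ : U ⊢ c ≤ b̂
      c≤b̂ = ≤-trans U c≤x′ (proj₁ x′<b̂)
      fb̂<fd : V ⊢ fun f b̂ < fun f d
      fb̂<fd = f-< b<gd
      Below-d : Carrier V → Set
      Below-d v = Σ (Carrier U) λ y → (U ⊢ y ≤ d) × fun f y ≡ v
      below-d : ∀ v → V ⊢ v ≤ fun f d → Below-d v
      below-d v h with Cond.surjective f v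
      ... | y , refl with ≤-total U y d
      ... | inj₁ y≤d = y , y≤d , refl
      ... | inj₂ d≤y = d , ≤-refl U , ≤-antisym V (Cond.monotone f d≤y) h
      b̂-lim : Lim V (fun f b̂)
      -- A successor is at most `fun f d`, so it has a preimage between `c` and `d` and would give a
      -- successor of `b` in `W`.
      b̂-lim v (b̂<v , least) with below-d v (least _ fb̂<fd)
      ... | y , y≤d , refl = b-lim (fun g y) (g-< c≤b̂ (proj₁ b̂<d) c≤y y≤d b̂<v , below)
        where
        c≤y : U ⊢ c ≤ y
        c≤y = ≤-trans U c≤b̂ (proj₁ (reflect-< f b̂<v))
        below : ∀ w → W ⊢ fun g b̂ < w → W ⊢ fun g y ≤ w
        below w b<w with ≤⊎> W (fun g y) w
        ... | inj₁ h = h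
        ... | inj₂ w<gy with Cond.surjective g w
        ... | z , refl = ⊥-elim (<⇒≱ V (f-< w<gy)
              (least (fun f z) (f-< b<w)))

  -- Limits obtained from a copy of the rationals

  module Dense (L : LO) (e : ℚ → Carrier L) (e-< : ∀ a q → a ℚ.< q → L ⊢ e a < e q) where

    -- Collapsing each J q to e q turns every e q into a limit from both sides.  Points in irrational
    -- cuts are kept, as there is no canonical representative to collapse them to.
    J : ℚ → Carrier L → Set
    J q x = (∀ a → a ℚ.< q → L ⊢ e a < x) × (∀ a → q ℚ.< a → L ⊢ x < e a)

    J-e : ∀ q → J q (e q)
    J-e q = (λ a → e-< a q) , (λ a → e-< q a)

    -- If `q` were less than `a`, a rational strictly between them would put `y` below `x`.
    J-mono : ∀ {a q x y} → J a x → J q y → L ⊢ x ≤ y → L ⊢ e a ≤ e q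
    J-mono {a} {q} (below , _) (_ , above) x≤y with ℚ.<-cmp a q
    ... | tri< a<q _ _  = proj₁ (e-< a q a<q)
    ... | tri≈ _ refl _ = ≤-refl L
    ... | tri> _ _ q<a with ℚ.<-dense q<a
    ... | m , q<m , m<a = ⊥-elim (<⇒≱ L (below m m<a) (≤-trans L x≤y (proj₁ (above m q<m))))

    J-unique : ∀ {a q} → J a (e q) → a ≡ q
    J-unique {a} {q} (below , above) with ℚ.<-cmp a q
    ... | tri< a<q _ _ = ⊥-elim (proj₂ (above q a<q) refl)
    ... | tri≈ _ a≡q _ = a≡q
    ... | tri> _ _ q<a = ⊥-elim (proj₂ (below q q<a) refl)

    private
      C : Carrier L → Carrier L → Set
      C x z = Σ ℚ λ q → J q x × z ≡ e q

    cuts : Collapse L (λ x y → Σ (Carrier L) λ z → C x z × C y z)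
    cuts = collapse L C
      (λ { (q , _ , refl) → q , J-e q , refl })
      (λ { (a , j , refl) (q , k , refl) → J-mono j k })
      (λ { (q , (below , _) , refl) x≤y y≤z →
           q , ((λ a a<q → <-≤-trans L (below a a<q) x≤y) , λ a q<a → ≤-<-trans L y≤z (e-< q a q<a)) , refl })
      (λ { (q , (_ , above) , refl) z≤y y≤x →
           q , ((λ a a<q → <-≤-trans L (e-< a q a<q) z≤y) , λ a q<a → ≤-<-trans L y≤x (above a q<a)) , refl })

    open Collapse cuts public

    fe-< : ∀ {a q} → a ℚ.< q → V ⊢ fun f (e a) < fun f (e q)
    fe-< {a} {q} a<q = preserve-< f ea<eq λ eq → [ proj₂ ea<eq , distinct ]′ (kernel eq)
      where
      ea<eq = e-< a q a<q
      distinct : ¬ Σ (Carrier L) λ z → C (e a) z × C (e q) z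
      distinct (_ , (r , j , refl) , s , k , r≡s) with J-unique j | J-unique k
      ... | refl | refl = proj₂ ea<eq r≡s

    -- Otherwise `x` would exceed `e a` for every `a` less than `q`, hence lie in `J q` and be glued
    -- to `e q`.
    cut-below : ∀ {x q} → V ⊢ fun f x < fun f (e q) → Σ ℚ λ a → a ℚ.< q × L ⊢ x ≤ e a
    cut-below {x} {q} x<q with em₀ {Σ ℚ λ a → a ℚ.< q × L ⊢ x ≤ e a}
    ... | yes h = h
    ... | no k  = ⊥-elim (proj₂ x<q (glue (e q , (q , j , refl) , (q , J-e q , refl))))
      where
      j : J q x
      j = (λ a a<q → ≰⇒> L λ h → k (a , a<q , h)) ,
          (λ a q<a → ≤-<-trans L (proj₁ (reflect-< f x<q)) (e-< q a q<a))

    cut-above : ∀ {x q} → V ⊢ fun f (e q) < fun f x → Σ ℚ λ a → q ℚ.< a × L ⊢ e a ≤ x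
    cut-above {x} {q} q<x with em₀ {Σ ℚ λ a → q ℚ.< a × L ⊢ e a ≤ x}
    ... | yes h = h
    ... | no k  = ⊥-elim (proj₂ q<x (glue (e q , (q , J-e q , refl) , (q , j , refl))))
      where
      j : J q x
      j = (λ a a<q → <-≤-trans L (e-< a q a<q) (proj₁ (reflect-< f q<x))) ,
          (λ a q<a → ≰⇒> L λ h → k (a , q<a , h))

    -- Any point above `e q` after the collapse is above some `e a` with `a` greater than `q`;
    -- density puts another image in between.
    e-lim : ∀ q → Lim V (fun f (e q))
    e-lim q y′ (q<y′ , least) with Cond.surjective f y′
    ... | y , refl with cut-above q<y′
    ... | a , q<a , ea≤y with ℚ.<-dense q<a
    ... | m , q<m , m<a = <⇒≱ V (<-≤-trans V (fe-< m<a) (Cond.monotone f ea≤y)) (least _ (fe-< q<m))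

    e-limBelow : ∀ q → LimBelow V (fun f (e q))
    e-limBelow q v v<q with Cond.surjective f v
    ... | x , refl with cut-below v<q
    ... | a , a<q , x≤ea with ℚ.<-dense a<q
    ... | m , a<m , m<q = fun f (e m) , ≤-<-trans V (Cond.monotone f x≤ea) (fe-< a<m) , fe-< m<q , e-lim m

-- Labelling condensations by the worlds of a finite frame

open Equivalence using (to; from)

-- Formulas for successors, limits and chains

wk : ∀ {W n} → Tm W n → Tm W (suc n)
wk (var i)   = var (suc i)
wk (const w) = const w

⟦wk⟧ : ∀ {W U n} (s : Tm W n) {g : Cond W U} {a ν} → ⟦ wk s ⟧ g (extend a ν) ≡ ⟦ s ⟧ g ν
⟦wk⟧ (var i)   = refl
⟦wk⟧ (const w) = refl

_<'_ : ∀ {W n} → Tm W n → Tm W n → Fm W n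
s <' t = (s ≤' t) ∧' ((s ≐ t) ⇒ ⊥')

succ' : ∀ {W n} → Tm W n → Tm W n → Fm W n
succ' s t = (s <' t) ∧' ∀' ((wk s <' var zero) ⇒ (wk t ≤' var zero))

lim' : ∀ {W n} → Tm W n → Fm W n
lim' s = ∀' (succ' (wk s) (var zero) ⇒ ⊥')

limBelow' : ∀ {W n} → Carrier W → Fm W n
limBelow' d = ∀' ((var zero <' const d) ⇒
  ∃' ((var (suc zero) <' var zero) ∧' ((var zero <' const d) ∧' lim' (var zero))))

chain' : ∀ {W n} → ℕ → Tm W n → Fm W n
chain' zero    s = ⊥' ⇒ ⊥'
chain' (suc i) s = ∃' (succ' (wk s) (var zero) ∧' chain' i (var zero))

module _ {W U : LO} (g : Cond W U) where

  -- Values come with equations, because a weakened term has its old value only up to `⟦wk⟧`.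
  sat-< : ∀ {n} (ν : Fin n → Carrier U) s t {x y} → ⟦ s ⟧ g ν ≡ x → ⟦ t ⟧ g ν ≡ y →
    Sat U g ν (s <' t) ⇔ (U ⊢ x < y)
  sat-< ν s t refl refl = mk⇔
    (λ (lift h , k) → h , λ e → lower (k (lift e)))
    (λ (h , k) → lift h , λ (lift e) → lift (k e))

  sat-succ : ∀ {n} (ν : Fin n → Carrier U) s t {x y} → ⟦ s ⟧ g ν ≡ x → ⟦ t ⟧ g ν ≡ y →
    Sat U g ν (succ' s t) ⇔ Succ U x y
  sat-succ ν s t refl refl = mk⇔
    (λ (h , k) → to (sat-< ν s t refl refl) h , λ z x<z →
      subst (U ⊢_≤ z) (⟦wk⟧ t) (lower (k z (from (sat-< (extend z ν) (wk s) (var zero) (⟦wk⟧ s) refl) x<z))))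
    (λ (h , k) → from (sat-< ν s t refl refl) h , λ z x<z →
      lift (subst (U ⊢_≤ z) (sym (⟦wk⟧ t)) (k z (to (sat-< (extend z ν) (wk s) (var zero) (⟦wk⟧ s) refl) x<z))))

  sat-lim : ∀ {n} (ν : Fin n → Carrier U) s → Sat U g ν (lim' s) ⇔ Lim U (⟦ s ⟧ g ν)
  sat-lim ν s = mk⇔
    (λ h y k → lower (h y (from (sat-succ (extend y ν) (wk s) (var zero) (⟦wk⟧ s) refl) k)))
    (λ h y k → lift (h y (to (sat-succ (extend y ν) (wk s) (var zero) (⟦wk⟧ s) refl) k)))

  sat-limBelow : ∀ {n} (ν : Fin n → Carrier U) d → Sat U g ν (limBelow' d) ⇔ LimBelow U (fun g d)
  sat-limBelow ν d = mk⇔ forward backward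
    where
    forward : Sat U g ν (limBelow' d) → LimBelow U (fun g d)
    forward h x x<d with h x (from (sat-< (extend x ν) (var zero) (const d) refl refl) x<d)
    ... | lift b , x<b , b<d , l = b , to (sat-< μ (var (suc zero)) (var zero) refl refl) x<b ,
          to (sat-< μ (var zero) (const d) refl refl) b<d , to (sat-lim μ (var zero)) l
      where μ = extend b (extend x ν)
    backward : LimBelow U (fun g d) → Sat U g ν (limBelow' d)
    backward h x x<d with h x (to (sat-< (extend x ν) (var zero) (const d) refl refl) x<d)
    ... | b , x<b , b<d , l = lift b , from (sat-< μ (var (suc zero)) (var zero) refl refl) x<b ,
          from (sat-< μ (var zero) (const d) refl refl) b<d , from (sat-lim μ (var zero)) l
      where μ = extend b (extend x ν)

  sat-chain : ∀ {n} (ν : Fin n → Carrier U) i s {x} → ⟦ s ⟧ g ν ≡ x → Sat U g ν (chain' i s) ⇔ Chain U i x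
  sat-chain ν zero s e = mk⇔ (λ _ → tt) (λ _ b → b)
  sat-chain ν (suc i) s e = mk⇔
    (λ (lift y , h , k) → y , to (sat-succ (extend y ν) (wk s) (var zero) (trans (⟦wk⟧ s) e) refl) h ,
      to (sat-chain (extend y ν) i (var zero) refl) k)
    (λ (y , h , k) → lift y , from (sat-succ (extend y ν) (wk s) (var zero) (trans (⟦wk⟧ s) e) refl) h ,
      from (sat-chain (extend y ν) i (var zero) refl) k)

Chain-≤ : ∀ {U i j x} → i ℕ.≤ j → Chain U j x → Chain U i x
Chain-≤ ℕ.z≤n _ = tt
Chain-≤ (ℕ.s≤s h) (y , s , k) = y , s , Chain-≤ h k

-- Sentences depending on the truth values of other sentences

module Reading (em : ExcludedMiddle (lsuc 0ℓ)) {W : LO} where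

  bool' : Bool → Sentence W
  bool' true  = ⊥' ⇒ ⊥'
  bool' false = ⊥'

  ite' : Sentence W → (Bool → Sentence W) → Sentence W
  ite' φ h = (φ ∧' h true) ∨' ((φ ⇒ ⊥') ∧' h false)

  -- Shannon expansion: a sentence may depend on the truth values of finitely many others.
  read' : ∀ {n} → (Fin n → Sentence W) → (Vec Bool n → Sentence W) → Sentence W
  read' {zero}  θ h = h []
  read' {suc n} θ h = ite' (θ zero) λ b → read' (λ i → θ (suc i)) λ v → h (b ∷ v)

  -- Searches `m` sentences from index `j` on for the first that fails; if none does, the result is
  -- `j` plus `m`.
  count' : (ℕ → Sentence W) → ℕ → ℕ → (ℕ → Sentence W) → Sentence W
  count' θ j zero    h = h j
  count' θ j (suc m) h = ite' (θ j) λ b → if b then count' θ (suc j) m h else h j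

  module _ {U : LO} (g : Cond W U) (ν : Fin 0 → Carrier U) where

    sat? : Sentence W → Bool
    sat? φ = does (em {Sat U g ν φ})

    sat?-true : ∀ φ → Sat U g ν φ → sat? φ ≡ true
    sat?-true φ s with em {Sat U g ν φ}
    ... | yes _ = refl
    ... | no k  = ⊥-elim (k s)

    sat?-false : ∀ φ → ¬ Sat U g ν φ → sat? φ ≡ false
    sat?-false φ k with em {Sat U g ν φ}
    ... | yes s = ⊥-elim (k s)
    ... | no _  = refl

    true-sat? : ∀ φ → sat? φ ≡ true → Sat U g ν φ
    true-sat? φ e with em {Sat U g ν φ} | e
    ... | yes s | _ = s

    bits : ∀ {n} → (Fin n → Sentence W) → Vec Bool n
    bits {zero}  θ = []
    bits {suc n} θ = sat? (θ zero) ∷ bits (λ i → θ (suc i))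

    lookup-bits : ∀ {n} (θ : Fin n → Sentence W) i → lookup (bits θ) i ≡ sat? (θ i)
    lookup-bits θ zero    = refl
    lookup-bits θ (suc i) = lookup-bits (λ i → θ (suc i)) i

    count : (ℕ → Sentence W) → ℕ → ℕ → ℕ
    count θ j zero    = j
    count θ j (suc m) = if sat? (θ j) then count θ (suc j) m else j

    sat-bool : ∀ b → Sat U g ν (bool' b) ⇔ (b ≡ true)
    sat-bool true  = mk⇔ (λ _ → refl) (λ _ b → b)
    sat-bool false = mk⇔ (λ ()) (λ ())

    sat-ite : ∀ φ h → Sat U g ν (ite' φ h) ⇔ Sat U g ν (h (sat? φ))
    sat-ite φ h with em {Sat U g ν φ}
    ... | yes s = mk⇔ (λ { (inj₁ (_ , x)) → x ; (inj₂ (k , _)) → ⊥-elim (lower (k s)) }) (λ x → inj₁ (s , x))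
    ... | no k  = mk⇔ (λ { (inj₁ (s , _)) → ⊥-elim (k s) ; (inj₂ (_ , x)) → x }) (λ x → inj₂ ((λ s → lift (k s)) , x))

    sat-read : ∀ {n} (θ : Fin n → Sentence W) h → Sat U g ν (read' θ h) ⇔ Sat U g ν (h (bits θ))
    sat-read {zero} θ h = mk⇔ (λ x → x) (λ x → x)
    sat-read {suc n} θ h = mk⇔
      (λ x → to (sat-read θ⁺ (h⁺ (sat? (θ zero)))) (to (sat-ite (θ zero) (λ b → read' θ⁺ (h⁺ b))) x))
      (λ x → from (sat-ite (θ zero) (λ b → read' θ⁺ (h⁺ b))) (from (sat-read θ⁺ (h⁺ (sat? (θ zero)))) x))
      where
      θ⁺ : Fin n → Sentence W
      θ⁺ i = θ (suc i)
      h⁺ : Bool → Vec Bool n → Sentence W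
      h⁺ b v = h (b ∷ v)

    sat-count : ∀ θ j m h → Sat U g ν (count' θ j m h) ⇔ Sat U g ν (h (count θ j m))
    sat-count θ j zero h = mk⇔ (λ x → x) (λ x → x)
    sat-count θ j (suc m) h = mk⇔
      (λ x → to (branch (sat? (θ j))) (to (sat-ite (θ j) next) x))
      (λ x → from (sat-ite (θ j) next) (from (branch (sat? (θ j))) x))
      where
      next : Bool → Sentence W
      next b = if b then count' θ (suc j) m h else h j
      branch : ∀ b → Sat U g ν (if b then count' θ (suc j) m h else h j) ⇔
        Sat U g ν (h (if b then count θ (suc j) m else j))
      branch true  = sat-count θ (suc j) m h
      branch false = mk⇔ (λ x → x) (λ x → x)

    count-≡ : ∀ θ d j m → j ℕ.≤ d → d ℕ.< j ℕ.+ m →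
      (∀ i → i ℕ.< d → Sat U g ν (θ i)) → ¬ Sat U g ν (θ d) → count θ j m ≡ d
    count-≡ θ d j zero j≤d d<j _ _ = ⊥-elim (ℕ.<⇒≱ d<j (subst (ℕ._≤ d) (sym (ℕ.+-identityʳ j)) j≤d))
    count-≡ θ d j (suc m) j≤d d<j below at with ℕ.m≤n⇒m<n∨m≡n j≤d
    ... | inj₁ j<d rewrite sat?-true (θ j) (below j j<d) =
          count-≡ θ d (suc j) m j<d (subst (d ℕ.<_) (ℕ.+-suc j m) d<j) below at
    ... | inj₂ refl rewrite sat?-false (θ j) at = refl

-- Worlds selected by buttons and dial

module Labelling (em : ExcludedMiddle (lsuc 0ℓ)) (F : Frame) (w₀ : Frame.X F) (d₀ : ℕ) where
  open Frame F
  open Classical em using (em₀)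

  module _ {n : ℕ} (e : Fin n → X) (P : Fin n → Set) where

    -- The root is treated as a member of every chain, so the maximum is `w₀` when no button is
    -- pressed.
    record IsChain : Set where
      field
        above-root : ∀ {i} → P i → R w₀ (e i)
        comparable : ∀ {i j} → P i → P j → R (e i) (e j) ⊎ R (e j) (e i)

    record IsMax (m : X) : Set where
      field
        member     : m ≡ w₀ ⊎ Σ (Fin n) λ i → P i × m ≡ e i
        above-root : R w₀ m
        above      : ∀ {i} → P i → R (e i) m

  chain-max : ∀ {n} (e : Fin n → X) P → IsChain e P → Σ X (IsMax e P)
  chain-max {zero} e P c = w₀ , record { member = inj₁ refl ; above-root = R-refl ; above = λ { {()} } }
  chain-max {suc n} e P c with em₀ {P zero} | chain-max (λ i → e (suc i)) (λ i → P (suc i))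
    (record { above-root = IsChain.above-root c ; comparable = IsChain.comparable c })
  ... | no k | m , x = m , record
        { member = [ inj₁ , (λ (i , q) → inj₂ (suc i , q)) ]′ (IsMax.member x)
        ; above-root = IsMax.above-root x
        ; above = λ { {zero} q → ⊥-elim (k q) ; {suc i} q → IsMax.above x q } }
  ... | yes q₀ | m , x with compare
    where
    compare : R m (e zero) ⊎ R (e zero) m
    compare with IsMax.member x
    ... | inj₁ refl         = inj₁ (IsChain.above-root c q₀)
    ... | inj₂ (i , q , refl) = IsChain.comparable c q q₀
  ... | inj₁ m≤e = e zero , record
        { member = inj₂ (zero , q₀ , refl)
        ; above-root = IsChain.above-root c q₀
        ; above = λ { {zero} _ → R-refl ; {suc i} q → R-trans (IsMax.above x q) m≤e } }
  ... | inj₂ e≤m = m , record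
        { member = [ inj₁ , (λ (i , q) → inj₂ (suc i , q)) ]′ (IsMax.member x)
        ; above-root = IsMax.above-root x
        ; above = λ { {zero} _ → e≤m ; {suc i} q → IsMax.above x q } }

  _∈ᵇ_ : ∀ {n} → Fin n → Vec Bool n → Set
  i ∈ᵇ S = lookup S i ≡ true

  abstract
    β : Vec Bool size → X
    β S with em₀ {IsChain enum (_∈ᵇ S)}
    ... | yes c = proj₁ (chain-max enum (_∈ᵇ S) c)
    ... | no _  = τ

    β-chain : ∀ S → IsChain enum (_∈ᵇ S) → IsMax enum (_∈ᵇ S) (β S)
    β-chain S c with em₀ {IsChain enum (_∈ᵇ S)}
    ... | yes c = proj₂ (chain-max enum (_∈ᵇ S) c)
    ... | no k  = ⊥-elim (k c)

    β-top : ∀ S → ¬ IsChain enum (_∈ᵇ S) → β S ≡ τ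
    β-top S k with em₀ {IsChain enum (_∈ᵇ S)}
    ... | yes c = ⊥-elim (k c)
    ... | no _  = refl

  -- If the larger set is no chain, its value is the greatest world `τ`. Otherwise the smaller set
  -- is a chain too, and its maximum is the root or a member of the larger set.
  β-mono : ∀ S S′ → (∀ i → i ∈ᵇ S → i ∈ᵇ S′) → R (β S) (β S′)
  β-mono S S′ sub with em₀ {IsChain enum (_∈ᵇ S′)}
  ... | no k  = subst (R (β S)) (sym (β-top S′ k)) (top _)
  ... | yes c with IsMax.member (β-chain S record
                     { above-root = λ q → IsChain.above-root c (sub _ q)
                     ; comparable = λ q q′ → IsChain.comparable c (sub _ q) (sub _ q′) })
  ... | inj₁ e           = subst (λ x → R x (β S′)) (sym e) (IsMax.above-root (β-chain S′ c))
  ... | inj₂ (i , q , e) = subst (λ x → R x (β S′)) (sym e) (IsMax.above (β-chain S′ c) (sub i q))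

  nth : ℕ → X
  nth k with k ℕ.<? size
  ... | yes k<n = enum (fromℕ< k<n)
  ... | no _    = w₀

  nth-toℕ : ∀ i → nth (toℕ i) ≡ enum i
  nth-toℕ i with toℕ i ℕ.<? size
  ... | yes i<n = cong enum (fromℕ<-toℕ i i<n)
  ... | no k    = ⊥-elim (k (toℕ<n i))

  -- The dial shows w₀ at d₀ (its position at the starting world) and, on the
  -- remaining positions, all of the enumeration.
  δ : ℕ → X
  δ d with ℕ.<-cmp d d₀
  ... | tri< _ _ _ = nth d
  ... | tri≈ _ _ _ = w₀
  ... | tri> _ _ _ = nth (ℕ.pred d)

  δ-d₀ : δ d₀ ≡ w₀
  δ-d₀ with ℕ.<-cmp d₀ d₀
  ... | tri< l _ _ = ⊥-elim (ℕ.<-irrefl refl l)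
  ... | tri≈ _ _ _ = refl
  ... | tri> _ _ l = ⊥-elim (ℕ.<-irrefl refl l)

  δ-< : ∀ {d} → d ℕ.< d₀ → δ d ≡ nth d
  δ-< {d} l with ℕ.<-cmp d d₀
  ... | tri< _ _ _ = refl
  ... | tri≈ k _ _ = ⊥-elim (k l)
  ... | tri> k _ _ = ⊥-elim (k l)

  δ-> : ∀ {d} → d₀ ℕ.≤ d → δ (suc d) ≡ nth d
  δ-> {d} l with ℕ.<-cmp (suc d) d₀
  ... | tri< _ _ k = ⊥-elim (k (ℕ.s≤s l))
  ... | tri≈ _ _ k = ⊥-elim (k (ℕ.s≤s l))
  ... | tri> _ _ _ = refl

  -- Inserting `w₀` shifts the later worlds by one, hence the bound `size` inclusive.
  δ-surjective : ∀ x → Σ ℕ λ d → d ℕ.≤ size × δ d ≡ x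
  δ-surjective x with enum-index x
  ... | i , refl with toℕ i ℕ.<? d₀
  ... | yes l = toℕ i , ℕ.<⇒≤ (toℕ<n i) , trans (δ-< l) (nth-toℕ i)
  ... | no k  = suc (toℕ i) , toℕ<n i , trans (δ-> (ℕ.≮⇒≥ k)) (nth-toℕ i)

  _≈_ : X → X → Set
  x ≈ y = R x y × R y x

  abstract
    -- The fallback `β S` ensures that turning the dial never leaves the cluster.
    lab : Bool → Vec Bool size → ℕ → X
    lab false S d = τ
    lab true  S d with em₀ {δ d ≈ β S}
    ... | yes _ = δ d
    ... | no _  = β S

    lab-false : ∀ S d → lab false S d ≡ τ
    lab-false S d = refl

    lab-≈ : ∀ S d → lab true S d ≈ β S
    lab-≈ S d with em₀ {δ d ≈ β S}
    ... | yes h = h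
    ... | no _  = R-refl , R-refl

    lab-δ : ∀ S d → δ d ≈ β S → lab true S d ≡ δ d
    lab-δ S d h with em₀ {δ d ≈ β S}
    ... | yes _ = refl
    ... | no k  = ⊥-elim (k h)

-- The labelling as a bounded morphism

module Transfer (em : ExcludedMiddle (lsuc 0ℓ)) (F : Frame) (val : Frame.X F → ℕ → Bool) (w₀ : Frame.X F)
  (L : LO) (ν₀ : Fin 0 → Carrier L) (c : ℕ → Carrier L) (c-< : ∀ i → L ⊢ c i < c (suc i))
  (V₀ : LO) (f₀ : Cond L V₀)
  (f₀-< : V₀ ⊢ fun f₀ (c (Frame.size F)) < fun f₀ (c (suc (Frame.size F))))
  (f₀-lim : LimBelow V₀ (fun f₀ (c (suc (Frame.size F)))))
  where
  open Frame F
  open Forcing F val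
  open Classical em using (em₀)
  open Constructions em
  open Reading em {L}

  c∞ d∞ : Carrier L
  c∞ = c size
  d∞ = c (suc size)

  B : (V : LO) → Cond L V → Set
  B V g = (V ⊢ fun g c∞ < fun g d∞) × LimBelow V (fun g d∞)

  -- Quantifying over further condensations makes failure permanent.
  A : (V : LO) → Cond L V → Set₁
  A V g = Σ LO λ V′ → Σ (Cond V V′) λ f → B V′ (f ∘C g)

  Pressed : (V : LO) → Cond L V → Fin size → Set
  Pressed V g i = fun g (c (toℕ i)) ≡ fun g (c (suc (toℕ i)))

  A' : Sentence L
  A' = ◇' ((const c∞ <' const d∞) ∧' limBelow' d∞)

  pressed' : Fin size → Sentence L
  pressed' i = const (c (toℕ i)) ≐ const (c (suc (toℕ i)))

  -- With this shift the first failing index equals the length of the chain.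
  dial' : ℕ → Sentence L
  dial' i = chain' (suc i) (const c∞)

  position : {V : LO} → Cond L V → (Fin 0 → Carrier V) → ℕ
  position g ν = count g ν dial' 0 (suc size)

  open Labelling em F w₀ (position (idC L) ν₀)

  label : {V : LO} → Cond L V → (Fin 0 → Carrier V) → X
  label g ν = lab (sat? g ν A') (bits g ν pressed') (position g ν)

  σ-count : ℕ → Bool → Vec Bool size → ℕ → Sentence L
  σ-count i a S d = bool' (val (lab a S d) i)

  σ-read : ℕ → Bool → Vec Bool size → Sentence L
  σ-read i a S = count' dial' 0 (suc size) (σ-count i a S)

  σ-ite : ℕ → Bool → Sentence L
  σ-ite i a = read' pressed' (σ-read i a)

  -- Finitely many truth values determine the label; at each outcome `val` supplies a constant
  -- sentence.
  σ : ℕ → Sentence L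
  σ i = ite' A' (σ-ite i)

  module _ {V : LO} (g : Cond L V) (ν : Fin 0 → Carrier V) where

    sat-A : Sat V g ν A' ⇔ A V g
    sat-A = mk⇔
      (λ (V′ , f , h , k) → V′ , f ,
        to (sat-< (f ∘C g) (λ i → fun f (ν i)) (const c∞) (const d∞) refl refl) h ,
        to (sat-limBelow (f ∘C g) (λ i → fun f (ν i)) d∞) k)
      (λ (V′ , f , h , k) → V′ , f ,
        from (sat-< (f ∘C g) (λ i → fun f (ν i)) (const c∞) (const d∞) refl refl) h ,
        from (sat-limBelow (f ∘C g) (λ i → fun f (ν i)) d∞) k)

    sat-σ : ∀ i → Sat V g ν (σ i) ⇔ (val (label g ν) i ≡ true)
    sat-σ i = mk⇔
      (λ x → to (sat-bool g ν (val (label g ν) i)) (to e₃ (to e₂ (to e₁ x))))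
      (λ x → from e₁ (from e₂ (from e₃ (from (sat-bool g ν (val (label g ν) i)) x))))
      where
      a = sat? g ν A'
      S = bits g ν pressed'
      e₁ = sat-ite g ν A' (σ-ite i)
      e₂ = sat-read g ν pressed' (σ-read i a)
      e₃ = sat-count g ν dial' 0 (suc size) (σ-count i a S)

    bits-pressed : ∀ i → (i ∈ᵇ bits g ν pressed') ⇔ Pressed V g i
    bits-pressed i = mk⇔
      (λ e → lower (true-sat? g ν (pressed' i) (trans (sym (lookup-bits g ν pressed' i)) e)))
      (λ e → trans (lookup-bits g ν pressed' i) (sat?-true g ν (pressed' i) (lift e)))

    label-A : A V g → label g ν ≡ lab true (bits g ν pressed') (position g ν)
    label-A h = cong (λ a → lab a (bits g ν pressed') (position g ν)) (sat?-true g ν A' (from sat-A h))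

    label-¬A : ¬ A V g → label g ν ≡ τ
    label-¬A k = trans
      (cong (λ a → lab a (bits g ν pressed') (position g ν)) (sat?-false g ν A' (λ s → k (to sat-A s))))
      (lab-false (bits g ν pressed') (position g ν))

    position-≡ : ∀ d → d ℕ.≤ size → Chain V d (fun g c∞) → ¬ Chain V (suc d) (fun g c∞) → position g ν ≡ d
    position-≡ d d≤n ch nch = count-≡ g ν dial' d 0 (suc size) ℕ.z≤n (ℕ.s≤s d≤n)
      (λ i i<d → from (sat-chain g ν (suc i) (const c∞) refl) (Chain-≤ i<d ch))
      (λ s → nch (to (sat-chain g ν (suc d) (const c∞) refl) s))

  c-≤ : ∀ {i j} → i ℕ.≤ j → L ⊢ c i ≤ c j
  c-≤ {i} h = go (ℕ.≤⇒≤′ h)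
    where
    go : ∀ {j} → i ℕ.≤′ j → L ⊢ c i ≤ c j
    go ℕ.≤′-refl     = ≤-refl L
    go (ℕ.≤′-step h) = ≤-trans L (go h) (proj₁ (c-< _))

  -- Consecutive points `c i` differ in `L`, so no button is pressed, and `δ` shows `w₀` at the
  -- initial position.
  label-L : label (idC L) ν₀ ≡ w₀
  label-L = trans (label-A (idC L) ν₀ (V₀ , f₀ , f₀-< , f₀-lim))
    (trans (lab-δ S (position (idC L) ν₀) (subst (_≈ β S) (sym δ-d₀) (subst (w₀ ≈_) (sym β≡w₀) (R-refl , R-refl)))) δ-d₀)
    where
    S = bits (idC L) ν₀ pressed'
    none : ∀ {i} → ¬ (i ∈ᵇ S)
    none {i} q = proj₂ (c-< (toℕ i)) (to (bits-pressed (idC L) ν₀ i) q)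
    β≡w₀ : β S ≡ w₀
    β≡w₀ with IsMax.member (β-chain S record
               { above-root = λ q → ⊥-elim (none q) ; comparable = λ q → ⊥-elim (none q) })
    ... | inj₁ e           = e
    ... | inj₂ (i , q , _) = ⊥-elim (none q)

  module _ {V : LO} (g : Cond L V) (ν : Fin 0 → Carrier V) where

    -- Pressed buttons stay pressed, and `A` at the target implies `A` at the source. Where `A`
    -- fails, the label is `τ`, seen from everywhere.
    forth : ∀ {V′} (f : Cond V V′) → R (label g ν) (label (f ∘C g) (λ i → fun f (ν i)))
    forth {V′} f with em {A V g} | em {A V′ (f ∘C g)}
    ... | _ | no k′ = subst (R _) (sym (label-¬A (f ∘C g) _ k′)) (top _)
    ... | no k | yes (V″ , f′ , b) = ⊥-elim (k (V″ , (f′ ∘C f) , b))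
    ... | yes a | yes a′ = subst₂ R (sym (label-A g ν a)) (sym (label-A (f ∘C g) _ a′))
          (R-trans (proj₁ (lab-≈ _ _)) (R-trans (β-mono _ _ sub) (proj₂ (lab-≈ _ _))))
      where
      sub : ∀ i → i ∈ᵇ bits g ν pressed' → i ∈ᵇ bits (f ∘C g) (λ i → fun f (ν i)) pressed'
      sub i q = from (bits-pressed (f ∘C g) _ i) (cong (fun f) (to (bits-pressed g ν i) q))

    back-τ : Σ LO λ V′ → Σ (Cond V V′) λ f → label (f ∘C g) (λ i → fun f (ν i)) ≡ τ
    back-τ = 𝟙 , ! V , label-¬A (! V ∘C g) _ λ (V′ , f , c<d , _) → proj₂ c<d refl

    record Moved (j : Fin size) (d : ℕ) : Set₁ where
      field
        V′      : LO
        f       : Cond V V′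
        ready   : B V′ (f ∘C g)
        pressed : ∀ i → Pressed V′ (f ∘C g) i ⇔ (Pressed V g i ⊎ i ≡ j)
        exact   : Chain V′ d (fun f (fun g c∞)) × ¬ Chain V′ (suc d) (fun f (fun g c∞))

    -- Localising and setting the dial are injective up to `c∞`, where all buttons lie; only the
    -- collapse between them presses anything.
    assemble : ∀ j d (E₂ : Extension V (fun g c∞) (fun g d∞)) → let open Extension E₂ renaming (V to V₂; f to f₂) in
      (P₃ : Press V₂ (fun f₂ (fun g (c (toℕ j)))) (fun f₂ (fun g (c (suc (toℕ j))))) (fun f₂ (fun g c∞)) (fun f₂ (fun g d∞))) →
      let open Collapse (proj₁ P₃) renaming (V to V₃; f to f₃) in
      Dial d V₃ (fun f₃ (fun f₂ (fun g c∞))) (fun f₃ (fun f₂ (fun g d∞))) → Moved j d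
    assemble j d E₂ P₃ D₄ = record
      { V′ = V′
      ; f = f₄ ∘C (f₃ ∘C f₂)
      ; ready = E₄.c<d , E₄.limBelow
      ; pressed = λ i → mk⇔ (only i) λ
          { (inj₁ e)    → cong (λ x → fun f₄ (fun f₃ (fun f₂ x))) e
          ; (inj₂ refl) → cong (fun f₄) (glue ((≤-refl V₂ , step j) , (step j , ≤-refl V₂))) }
      ; exact = proj₂ D₄
      }
      where
      module E₂ = Extension E₂
      open E₂ using () renaming (V to V₂; f to f₂)
      open Collapse (proj₁ P₃) using (glue; kernel) renaming (V to V₃; f to f₃)
      module E₄ = Extension (proj₁ D₄)
      open E₄ using () renaming (V to V′; f to f₄)
      point : ℕ → Carrier V₂
      point i = fun f₂ (fun g (c i))
      point-≤ : ∀ {i j} → i ℕ.≤ j → V₂ ⊢ point i ≤ point j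
      point-≤ h = Cond.monotone f₂ (Cond.monotone g (c-≤ h))
      step : ∀ (i : Fin size) → V₂ ⊢ point (toℕ i) ≤ point (suc (toℕ i))
      step i = point-≤ (ℕ.n≤1+n _)
      unpressed : ∀ (i : Fin size) → point (toℕ i) ≡ point (suc (toℕ i)) → Pressed V g i
      unpressed i = E₂.injective (Cond.monotone g (c-≤ (ℕ.<⇒≤ (toℕ<n i)))) (Cond.monotone g (c-≤ (toℕ<n i)))
      only : ∀ i → fun f₄ (fun f₃ (point (toℕ i))) ≡ fun f₄ (fun f₃ (point (suc (toℕ i)))) →
        Pressed V g i ⊎ i ≡ j
      only i e with kernel (E₄.injective (Cond.monotone f₃ (point-≤ (ℕ.<⇒≤ (toℕ<n i))))
                             (Cond.monotone f₃ (point-≤ (toℕ<n i))) e)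
      ... | inj₁ e′ = inj₁ (unpressed i e′)
      -- If both points of button `i` lie in the interval glued for another `j`, monotonicity makes
      -- them equal already in `V₂`.
      ... | inj₂ ((j≤i , _) , (_ , i≤j)) with ℕ.<-cmp (toℕ i) (toℕ j)
      ... | tri≈ _ i≡j _ = inj₂ (toℕ-injective i≡j)
      ... | tri< i<j _ _ = inj₁ (unpressed i (≤-antisym V₂ (step i) (≤-trans V₂ (point-≤ i<j) j≤i)))
      ... | tri> _ _ j<i = inj₁ (unpressed i (≤-antisym V₂ (step i) (≤-trans V₂ i≤j (point-≤ j<i))))

    abstract
      -- `localise` comes first, as `f₁` may press unwanted buttons; the dial comes last, so that
      -- its reading refers to the final order.
      move : A V g → ∀ j d → Moved j d
      move (V₁ , f₁ , c<d , lim) j d = assemble j d E₂ P₃ (dial d _ (proj₁ (proj₂ P₃)) (proj₂ (proj₂ P₃)))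
        where
        E₂ : Extension V (fun g c∞) (fun g d∞)
        E₂ = localise f₁ (Cond.monotone g (proj₁ (c-< size))) c<d lim
        open Extension E₂ using () renaming (V to V₂; f to f₂; c<d to c<d₂; limBelow to lim₂)
        P₃ : Press V₂ (fun f₂ (fun g (c (toℕ j)))) (fun f₂ (fun g (c (suc (toℕ j))))) (fun f₂ (fun g c∞)) (fun f₂ (fun g d∞))
        P₃ = press V₂ (Cond.monotone f₂ (Cond.monotone g (proj₁ (c-< (toℕ j)))))
               (Cond.monotone f₂ (Cond.monotone g (c-≤ (toℕ<n j)))) c<d₂ lim₂

    -- Were the pressed worlds no chain, the label would share a cluster with `τ`, which is alone in
    -- its own.
    active : label g ν ≢ τ → A V g × IsChain enum (_∈ᵇ bits g ν pressed')
    active ne with em {A V g}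
    ... | no k = ⊥-elim (ne (label-¬A g ν k))
    ... | yes a with em₀ {IsChain enum (_∈ᵇ bits g ν pressed')}
    ... | yes ch = a , ch
    ... | no k = ⊥-elim (ne (trans (label-A g ν a)
                   (final (subst (λ x → R x (lab true S d)) (β-top S k) (proj₂ (lab-≈ S d))))))
      where
      S = bits g ν pressed'
      d = position g ν

    -- For `y` other than `τ`, press its button and turn the dial to it. All worlds pressed before
    -- see `β S`, which sees `y`; so the chain persists and its maximum enters the cluster of `y`.
    back : ∀ y → R (label g ν) y → Σ LO λ V′ → Σ (Cond V V′) λ f → label (f ∘C g) (λ i → fun f (ν i)) ≡ y
    back y r with em₀ {y ≡ τ}
    ... | yes refl = back-τ
    ... | no y≢τ with active (λ e → y≢τ (final (subst (λ x → R x y) e r))) | enum-index y | δ-surjective y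
    ... | a , ch | j , j≡y | d , d≤n , δd≡y = V′ , f ,
          trans (label-A (f ∘C g) ν′ (V′ , idC V′ , ready)) (trans (cong (lab true S′) pos)
            (trans (lab-δ S′ d (subst (_≈ β S′) (sym δd≡y) (y≤β , β≤y))) δd≡y))
      where
      open Moved (move a j d)
      ν′ = λ i → fun f (ν i)
      S  = bits g ν pressed'
      S′ = bits (f ∘C g) ν′ pressed'
      pos : position (f ∘C g) ν′ ≡ d
      pos = position-≡ (f ∘C g) ν′ d d≤n (proj₁ exact) (proj₂ exact)
      β≤y₀ : R (β S) y
      β≤y₀ = R-trans (proj₂ (lab-≈ S (position g ν))) (subst (λ x → R x y) (label-A g ν a) r)
      cases : ∀ {i} → i ∈ᵇ S′ → (i ∈ᵇ S) ⊎ enum i ≡ y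
      cases {i} q with to (pressed i) (to (bits-pressed (f ∘C g) ν′ i) q)
      ... | inj₁ q′   = inj₁ (from (bits-pressed g ν i) q′)
      ... | inj₂ refl = inj₂ j≡y
      below-y : ∀ {i} → i ∈ᵇ S′ → R (enum i) y
      below-y q with cases q
      ... | inj₁ q′ = R-trans (IsMax.above (β-chain S ch) q′) β≤y₀
      ... | inj₂ e  = subst (λ x → R x y) (sym e) R-refl
      w₀≤y : R w₀ y
      w₀≤y = R-trans (IsMax.above-root (β-chain S ch)) β≤y₀
      chain : IsChain enum (_∈ᵇ S′)
      chain = record { above-root = root ; comparable = comp }
        where
        root : ∀ {i} → i ∈ᵇ S′ → R w₀ (enum i)
        root q with cases q
        ... | inj₁ q′ = IsChain.above-root ch q′
        ... | inj₂ e  = subst (R w₀) (sym e) w₀≤y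
        comp : ∀ {i k} → i ∈ᵇ S′ → k ∈ᵇ S′ → R (enum i) (enum k) ⊎ R (enum k) (enum i)
        comp q q′ with cases q | cases q′
        ... | inj₁ u | inj₁ u′ = IsChain.comparable ch u u′
        ... | inj₂ e | _       = inj₂ (subst (R _) (sym e) (below-y q′))
        ... | _      | inj₂ e  = inj₁ (subst (R _) (sym e) (below-y q))
      y≤β : R y (β S′)
      y≤β = subst (λ x → R x (β S′)) j≡y (IsMax.above (β-chain S′ chain)
              (from (bits-pressed (f ∘C g) ν′ j) (from (pressed j) (inj₂ refl))))
      β≤y : R (β S′) y
      β≤y with IsMax.member (β-chain S′ chain)
      ... | inj₁ e           = subst (λ x → R x y) (sym e) w₀≤y
      ... | inj₂ (i , q , e) = subst (λ x → R x y) (sym e) (below-y q)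

  -- Induction on `a`, with `forth` and `back` for the modalities.
  sat-forces : ∀ {V} (g : Cond L V) ν a → Sat V g ν (inst σ a) ⇔ Forces (label g ν) a
  sat-forces g ν (p i) = sat-σ g ν i
  sat-forces g ν ⊥ₚ = mk⇔ lower lift
  sat-forces g ν (a ⇒ₚ b) = mk⇔
    (λ h x → to (sat-forces g ν b) (h (from (sat-forces g ν a) x)))
    (λ h x → from (sat-forces g ν b) (h (to (sat-forces g ν a) x)))
  sat-forces g ν (a ∧ₚ b) = mk⇔
    (λ (x , y) → to (sat-forces g ν a) x , to (sat-forces g ν b) y)
    (λ (x , y) → from (sat-forces g ν a) x , from (sat-forces g ν b) y)
  sat-forces g ν (a ∨ₚ b) = mk⇔
    [ (λ x → inj₁ (to (sat-forces g ν a) x)) , (λ y → inj₂ (to (sat-forces g ν b) y)) ]′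
    [ (λ x → inj₁ (from (sat-forces g ν a) x)) , (λ y → inj₂ (from (sat-forces g ν b) y)) ]′
  sat-forces g ν (□ₚ a) = mk⇔
    (λ h y r → let (V′ , f , e) = back g ν y r in
      subst (λ x → Forces x a) e (to (sat-forces (f ∘C g) (λ i → fun f (ν i)) a) (h V′ f)))
    (λ h V′ f → from (sat-forces (f ∘C g) (λ i → fun f (ν i)) a) (h _ (forth g ν f)))
  sat-forces g ν (◇ₚ a) = mk⇔
    (λ (V′ , f , x) → _ , forth g ν f , to (sat-forces (f ∘C g) (λ i → fun f (ν i)) a) x)
    (λ (y , r , x) → let (V′ , f , e) = back g ν y r in
      V′ , f , from (sat-forces (f ∘C g) (λ i → fun f (ν i)) a) (subst (λ x → Forces x a) (sym e) x))

  val-forces : ∀ {a} → Val L a → Forces w₀ a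
  val-forces {a} h = subst (λ x → Forces x a) label-L
    -- `Val` has its own empty assignment, which agrees with `ν₀` pointwise.
    (to (sat-forces (idC L) ν₀ a) (Sat-cong (λ _ → refl) (λ ()) (inst σ a) (h σ)))

-- Completeness

-- For the second claim one non-scattered world suffices: validity everywhere implies validity here.
ℚ-order : LO
ℚ-order = record { Carrier = ℚ ; _≤_ = ℚ._≤_ ; isTotalOrder = ℚ.≤-isTotalOrder ; inhabitant = ℚ.0ℚ }

ℚ-non-scattered : ¬ Scattered ℚ-order
ℚ-non-scattered s = s ((λ q → q) , λ _ _ a<b → ℚ.<⇒≤ a<b , ℚ.<⇒≢ a<b)

numeral : ℕ → ℚ
numeral zero    = ℚ.0ℚ
numeral (suc n) = numeral n ℚ.+ ℚ.1ℚ

numeral-< : ∀ n → numeral n ℚ.< numeral (suc n)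
numeral-< n = subst (ℚ._< numeral (suc n)) (ℚ.+-identityʳ (numeral n))
                (ℚ.+-monoʳ-< (numeral n) (ℚ.positive⁻¹ ℚ.1ℚ))

module Completeness (em : ExcludedMiddle (lsuc 0ℓ)) where
  open Classical em

  refute : ∀ L (e : ℚ → Carrier L) → (∀ a b → a ℚ.< b → L ⊢ e a < e b) →
    ∀ ψ → Val L ψ → ¬ ¬ (⊢ ψ)
  refute L e e-< ψ valid unprovable = root-refutes (val-forces valid)
    where
    eventual = eventual-lits (base ψ) {¬ₚ ψ} λ h → unprovable (mp (⊢-dne _) h)
    open FiniteModel ψ (proj₁ eventual)
      -- Directedness upgrades the possibility of permanent signs to the boxed form `γ`.
      (consistent-mono (pair (fst hyp) (◇□⇒□◇□ · snd hyp)) (proj₂ eventual))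
    open Constructions em using (module Dense)
    open Dense L e e-<
    -- The collapse from `Dense` witnesses `A` at `L`; the button points are the images of the
    -- natural numbers under `e`.
    open Transfer em frame val root L (λ ()) (λ i → e (numeral i)) (λ i → e-< _ _ (numeral-< i))
      V f (fe-< (numeral-< (Frame.size frame))) (e-limBelow (numeral (suc (Frame.size frame))))

  completeness : ∀ L → ¬ Scattered L → ∀ ψ → Val L ψ → S4∙2∙1 ψ
  completeness L ns ψ valid with em₀ {S4∙2∙1 ψ}
  ... | yes h = h
  -- Non-scatteredness yields the embedding only under a double negation, which suffices for a
  -- contradiction.
  ... | no k  = ⊥-elim (ns λ (e , e-<) → refute L e e-< ψ valid k)

theorem8p4 : ExcludedMiddle (lsuc 0ℓ) →
    ((L : LO) → ¬ Scattered L →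
    (ψ : PF) → (Val L ψ → S4∙2∙1 ψ) × (S4∙2∙1 ψ → Val L ψ))
    × ((ψ : PF) → (((W : LO) → Val W ψ) → S4∙2∙1 ψ) × (S4∙2∙1 ψ → (W : LO) → Val W ψ))
theorem8p4 em =
  (λ L ns ψ → completeness L ns ψ , λ h σ → soundness (idC L) _ σ h) ,
  λ ψ → (λ valid → completeness ℚ-order ℚ-non-scattered ψ (valid ℚ-order)) , λ h W σ → soundness (idC W) _ σ h
  where
  open Completeness em
  open Soundness em
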